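{- Let $n\ge 1$ and let $D[1\ldots n]$ be an array storing a map $f:[n]\to[n]$ as the sequence $f(1),\ldots,f(n)$. If stability is required and it is not allowed to modify the elements of $f$ (the elements stored in $D$ may be moved, but their values may not be changed), then there is an algorithm that rearranges $f$ in-place in (nondecreasing) order of its elements, stably, in $\mathcal{O}(n)$ time using an auxiliary array $E[1\ldots n]$ plus $4\log n$ bits of additional space.
   Context: $[n]=\{1,2,\ldots,n\}$. Computation is on a unit-cost random access machine. "In-place" means that at termination the array $D[1\ldots n]$ contains the values $f(1),\ldots,f(n)$ in nondecreasing order. "Stably" means that equal elements keep their original relative order: elements are regarded as items with keys $f(i)$, and if $f(i)=f(j)$ with $i<j$, then the item initially at index $i$ precedes the item initially at index $j$ in the final order. $E[1\ldots n]$ is an auxiliary array of $n$ integers. "Plus $4\log n$ bits" means that besides $D$ and $E$ the algorithm uses 4 auxiliary variables of $\log n$ bits each (indices or values of magnitude $O(n)$). -}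

module Defs where

open import Data.Bool.Base as Bool using (Bool; true; false)
open import Data.Fin.Base as Fin using (Fin; toℕ)
open import Data.Integer.Base as ℤ using (ℤ; +_; ∣_∣)
open import Data.Nat.Base as ℕ using (ℕ; suc)
open import Data.Vec.Base using (Vec; allFin; lookup; _[_]≔_)
open import Function.Definitions using (Bijective)
open import Relation.Binary.PropositionalEquality using (_≡_)
import Data.Integer.Properties as ℤₚ
open import Relation.Nullary.Decidable.Core using (does)

infix  9 D[_] E[_]
infixl 7 _⊕_ _⊝_
infix  6 _≼_ _≐_
infixr 5 _∧_
infix  4 _≔_ E[_]≔_ D[_]≔_ _≔D[_]
infixr 3 _⨾_
infix  3 while_loop_ if_then_else_

-- Programs for a random access machine with the array D, the auxiliary
-- array E, and k auxiliary variables.  A program is a fixed finite text that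
-- does not depend on n.  There is no multiplication, so every intermediate
-- result of an expression is within a constant factor of the stored values.
-- The expression D[ e ] denotes the key of the element stored there.

data Expr (k : ℕ) : Set where
  lit       : ℤ → Expr k
  len       : Expr k
  var       : Fin k → Expr k
  D[_] E[_] : Expr k → Expr k
  _⊕_ _⊝_   : Expr k → Expr k → Expr k

data Cond (k : ℕ) : Set where
  _≼_ _≐_ : Expr k → Expr k → Cond k
  not     : Cond k → Cond k
  _∧_     : Cond k → Cond k → Cond k

-- The only write access to D is  D[ e ]≔ x, which puts down an element
-- previously picked up by  x ≔D[ e ].  Elements can thus be moved, but no new
-- value can be written into D, and the temporary storage needed for moving
-- an element is one of the k variables.

data Prog (k : ℕ) : Set where
  skip          : Prog k
  _≔_           : Fin k → Expr k → Prog k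
  E[_]≔_        : Expr k → Expr k → Prog k
  _≔D[_]        : Fin k → Expr k → Prog k
  D[_]≔_        : Expr k → Fin k → Prog k
  _⨾_           : Prog k → Prog k → Prog k
  if_then_else_ : Cond k → Prog k → Prog k → Prog k
  while_loop_     : Cond k → Prog k → Prog k

-- Unit-cost accounting: each operator, array access, variable access or
-- constant costs one step.

cost : ∀ {k} → Expr k → ℕ
cost (lit z) = 1
cost len     = 1
cost (var x) = 1
cost D[ e ]  = suc (cost e)
cost E[ e ]  = suc (cost e)
cost (d ⊕ e) = suc (cost d ℕ.+ cost e)
cost (d ⊝ e) = suc (cost d ℕ.+ cost e)

costᶜ : ∀ {k} → Cond k → ℕ
costᶜ (d ≼ e) = suc (cost d ℕ.+ cost e)
costᶜ (d ≐ e) = suc (cost d ℕ.+ cost e)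
costᶜ (not b) = suc (costᶜ b)
costᶜ (a ∧ b) = suc (costᶜ a ℕ.+ costᶜ b)

-- An element of the input is named by its initial (0-based) index i; its key
-- is f i.  Programs see only keys, never these names.

data Content (n : ℕ) : Set where
  word : ℤ → Content n
  item : Fin n → Content n

record State (n k : ℕ) : Set where
  constructor state
  field
    arrD : Vec (Fin n) n
    arrE : Vec ℤ n
    vars : Vec (Content n) k

open State public

initial : ∀ {n k} → Vec ℤ n → Vec (Content n) k → State n k
initial {n} es xs = state (allFin n) es xs

-- The 1-based integer denoted by an element of Fin n, as an index or a key.
int : ∀ {n} → Fin n → ℤ
int i = + suc (toℕ i)

value : ∀ {n} → (Fin n → Fin n) → Content n → ℤ
value f (word z) = z
value f (item i) = int (f i)

-- Deterministic big-step semantics.  An access outside 1 … n has no rule, so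
-- the program is stuck.

data Eval {n k} (f : Fin n → Fin n) (s : State n k) : Expr k → ℤ → Set where
  lit  : ∀ z → Eval f s (lit z) z
  len  : Eval f s len (+ n)
  var  : ∀ x → Eval f s (var x) (value f (lookup (vars s) x))
  D[_] : ∀ {e i} → Eval f s e (int i) → Eval f s D[ e ] (int (f (lookup (arrD s) i)))
  E[_] : ∀ {e i} → Eval f s e (int i) → Eval f s E[ e ] (lookup (arrE s) i)
  _⊕_  : ∀ {d e y z} → Eval f s d y → Eval f s e z → Eval f s (d ⊕ e) (y ℤ.+ z)
  _⊝_  : ∀ {d e y z} → Eval f s d y → Eval f s e z → Eval f s (d ⊝ e) (y ℤ.- z)

data Test {n k} (f : Fin n → Fin n) (s : State n k) : Cond k → Bool → Set where
  _≼_ : ∀ {d e y z} → Eval f s d y → Eval f s e z → Test f s (d ≼ e) (does (y ℤₚ.≤? z))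
  _≐_ : ∀ {d e y z} → Eval f s d y → Eval f s e z → Test f s (d ≐ e) (does (y ℤₚ.≟ z))
  not : ∀ {b v} → Test f s b v → Test f s (not b) (Bool.not v)
  _∧_ : ∀ {a b u v} → Test f s a u → Test f s b v → Test f s (a ∧ b) (u Bool.∧ v)

-- Run f B P s t s′: on the map f, program P started in s halts in s′ after
-- exactly t steps, and every integer it writes to E or to a variable has
-- magnitude at most B (a larger write has no rule).

data Run {n k} (f : Fin n → Fin n) (B : ℕ) :
         Prog k → State n k → ℕ → State n k → Set where

  skip : ∀ {s} → Run f B skip s 1 s

  assign : ∀ {s x e z} → Eval f s e z → ∣ z ∣ ℕ.≤ B →
    Run f B (x ≔ e) s (suc (cost e))
        (record s { vars = vars s [ x ]≔ word z })

  writeE : ∀ {s d e i z} → Eval f s d (int i) → Eval f s e z → ∣ z ∣ ℕ.≤ B →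
    Run f B (E[ d ]≔ e) s (suc (cost d ℕ.+ cost e))
        (record s { arrE = arrE s [ i ]≔ z })

  pickUp : ∀ {s x e i} → Eval f s e (int i) →
    Run f B (x ≔D[ e ]) s (suc (cost e))
        (record s { vars = vars s [ x ]≔ item (lookup (arrD s) i) })

  putDown : ∀ {s x e i a} → Eval f s e (int i) → lookup (vars s) x ≡ item a →
    Run f B (D[ e ]≔ x) s (suc (cost e))
        (record s { arrD = arrD s [ i ]≔ a })

  _⨾_ : ∀ {P Q s s′ s″ t u} → Run f B P s t s′ → Run f B Q s′ u s″ →
    Run f B (P ⨾ Q) s (t ℕ.+ u) s″

  ifTrue : ∀ {b P Q s s′ t} → Test f s b true → Run f B P s t s′ →
    Run f B (if b then P else Q) s (suc (costᶜ b ℕ.+ t)) s′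

  ifFalse : ∀ {b P Q s s′ t} → Test f s b false → Run f B Q s t s′ →
    Run f B (if b then P else Q) s (suc (costᶜ b ℕ.+ t)) s′

  whileTrue : ∀ {b P s s′ s″ t u} → Test f s b true →
    Run f B P s t s′ → Run f B (while b loop P) s′ u s″ →
    Run f B (while b loop P) s (suc (costᶜ b ℕ.+ (t ℕ.+ u))) s″

  whileFalse : ∀ {b P s} → Test f s b false →
    Run f B (while b loop P) s (suc (costᶜ b)) s

-- lookup a p is the element at position p, named by its initial index.

record StablySorted {n} (f : Fin n → Fin n) (a : Vec (Fin n) n) : Set where
  field
    rearranged : Bijective _≡_ _≡_ (lookup a)
    sorted     : ∀ p q → p Fin.≤ q → f (lookup a p) Fin.≤ f (lookup a q)
    stable     : ∀ p q → f (lookup a p) ≡ f (lookup a q) →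
                 lookup a p Fin.< lookup a q → p Fin.< q

module Submission where

-- With two auxiliary arrays this would be counting sort: one array would hold
-- the counters, indexed by key, the other the destination of each item.  A
-- single array can hold both after the following rearrangement.  Let the first
-- item of each key be a leader and every other item a repeat.  There are as
-- many repeats as there are positions that are not in the image of f.  So the
-- leader of key v can be moved to position v, and the repeats can be moved, in
-- their original order, to the positions outside the image (Grouped).
-- Afterwards entry v of E is free to serve as the counter of key v, because
-- the item at position v is the leader, and its destination is what the counter
-- ends with; the entry of any other position is not needed as a counter, and
-- can hold the destination of the repeat at that position.
--
-- The rearrangement itself needs, for each position, its slot and a mark
-- with three values (not in the image, in the image, and key already seen).
-- Slot and mark are stored together as slot + mark * (n + 1), which is at most
-- 3 n + 2 (Coded).  The next slot for a repeat always exists: otherwise all n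
-- slots would belong to other positions (slot-left, by the pigeonhole
-- principle).
--
-- For the ranks, the keys are counted again and the counts are summed up, so
-- that entry v of E becomes the last rank available to key v.  The positions
-- are then visited in descending order: each repeat takes the current value of
-- the counter of its key, which is decremented, and the leader is left with the
-- smallest rank (Ranked, stable-ranks).  As the repeats are in their original
-- order and come after their leader, this is the stable order.
--
-- Both times the items are moved to their addresses in E by swaps, each of which
-- puts one item into its final place (permute-correct).  Every one of the
-- constantly many loops makes at most 2 n iterations of bounded cost.

open import Defs
open import Data.Bool.Base using (T; true; false)
open import Data.Fin.Base as Fin using (Fin; zero; suc; toℕ; fromℕ<)
open import Data.Fin.Properties as Finₚ
  using (toℕ-injective; toℕ<n; toℕ-fromℕ<; any?; injective⇒≤; ∃-toSum)
open import Data.Fin.Permutation.Components using (transpose; transpose-inverse)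
open import Data.Integer.Base as ℤ using (ℤ; +≤+) renaming (+_ to pos)
import Data.Integer.Properties as ℤₚ
open import Data.Nat.Base using (ℕ; zero; suc; _+_; _*_; _≤_; _<_; _≤ᵇ_; z≤n; s≤s; s≤s⁻¹; s<s⁻¹)
open import Data.Nat.Properties renaming (_≟_ to _≟ⁿ_)
open import Data.Product.Base using (Σ-syntax; ∃; _×_; _,_; proj₁; proj₂)
open import Data.Sum.Base using (_⊎_; inj₁; inj₂)
open import Data.Unit.Base using (tt)
open import Data.Vec.Base
  using (Vec; []; _∷_; lookup; map; replicate; allFin; _[_]≔_)
open import Data.Vec.Properties
  using ( lookup∘update; lookup∘update′; lookup-map; map-[]≔; lookup-replicate
        ; tabulate∘lookup; tabulate-cong; lookup-allFin)
open import Function.Base using (_∘_; case_of_)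
open import Function.Definitions using (Injective)
open import Relation.Binary.Definitions using (tri<; tri≈; tri>)
open import Relation.Binary.PropositionalEquality
open import Relation.Nullary using (Dec; yes; no; ¬_; contradiction)
open import Relation.Nullary.Decidable using (dec-true; dec-false; ¬?; _×-dec_)
open import Relation.Unary using (Decidable)

-- Finite sets

injective⇒surjective : ∀ {n} (h : Fin n → Fin n) → Injective _≡_ _≡_ h →
  ∀ y → ∃ λ x → h x ≡ y
injective⇒surjective {n} h h-inj y with any? (λ x → h x Finₚ.≟ y)
... | yes x = x
... | no ¬x = contradiction (injective⇒≤ h+-inj) (<⇒≱ ≤-refl)
  where
  -- If y were missed, h could be extended to an injection of n + 1 points.
  h+ : Fin (suc n) → Fin n
  h+ zero    = y
  h+ (suc x) = h x

  h+-inj : Injective _≡_ _≡_ h+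
  h+-inj {zero}  {zero}  _  = refl
  h+-inj {zero}  {suc x} eq = contradiction (x , sym eq) ¬x
  h+-inj {suc x} {zero}  eq = contradiction (x , eq) ¬x
  h+-inj {suc x} {suc z} eq = cong suc (h-inj eq)

least : ∀ {n} {P : Fin n → Set} → Decidable P → ∃ P →
  ∃ λ i → P i × (∀ j → P j → i Fin.≤ j)
least {suc n} P? ∃P with P? zero
... | yes p = zero , p , λ _ _ → z≤n
... | no ¬p with ∃-toSum ∃P
...   | inj₁ p = contradiction p ¬p
...   | inj₂ ∃P′ with least (P? ∘ suc) ∃P′
...     | i , p , lower = suc i , p ,
          λ { zero q → contradiction q ¬p ; (suc j) q → s≤s (lower j q) }

below : ∀ {n k m} → k + suc m ≡ n → ∃ λ (p : Fin n) → toℕ p ≡ k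
below {k = k} {m} refl = fromℕ< k< , toℕ-fromℕ< k<
  where
  k< : k < k + suc m
  k< = m<m+n k (s≤s z≤n)

vec-ext : ∀ {a} {A : Set a} {n} {xs ys : Vec A n} →
  (∀ i → lookup xs i ≡ lookup ys i) → xs ≡ ys
vec-ext {xs = xs} {ys} eq =
  trans (sym (tabulate∘lookup xs)) (trans (tabulate-cong eq) (tabulate∘lookup ys))

-- Partial sums

-- ∑ h k is the sum of h over the elements of Fin n below k.
∑ : ∀ {n} → (Fin n → ℕ) → ℕ → ℕ
∑         h zero    = 0
∑ {zero}  h (suc k) = 0
∑ {suc n} h (suc k) = h zero + ∑ (h ∘ suc) k

∑-suc : ∀ {n} (h : Fin n → ℕ) p → ∑ h (suc (toℕ p)) ≡ ∑ h (toℕ p) + h p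
∑-suc h zero    = +-identityʳ (h zero)
∑-suc h (suc p) = trans (cong (h zero +_) (∑-suc (h ∘ suc) p)) (sym (+-assoc (h zero) _ _))

∑-monoʳ : ∀ {n} (h : Fin n → ℕ) {k l} → k ≤ l → ∑ h k ≤ ∑ h l
∑-monoʳ         h z≤n       = z≤n
∑-monoʳ {zero}  h (s≤s k≤l) = z≤n
∑-monoʳ {suc n} h (s≤s k≤l) = +-monoʳ-≤ (h zero) (∑-monoʳ (h ∘ suc) k≤l)

∑-monoˡ : ∀ {n} {g h : Fin n → ℕ} → (∀ p → g p ≤ h p) → ∀ k → ∑ g k ≤ ∑ h k
∑-monoˡ         g≤h zero    = z≤n
∑-monoˡ {zero}  g≤h (suc k) = z≤n
∑-monoˡ {suc n} g≤h (suc k) = +-mono-≤ (g≤h zero) (∑-monoˡ (g≤h ∘ suc) k)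

∑-bound : ∀ {n} {h : Fin n → ℕ} {c} → (∀ p → h p ≤ c) → ∀ k → ∑ h k ≤ k * c
∑-bound         h≤c zero    = z≤n
∑-bound {zero}  h≤c (suc k) = z≤n
∑-bound {suc n} h≤c (suc k) = +-mono-≤ (h≤c zero) (∑-bound (h≤c ∘ suc) k)

-- If only the summand at i can increase, the total increases by no more than it;
-- a and b bound the difference without truncated subtraction.
∑-change : ∀ {n} {g h : Fin n → ℕ} a b i → g i + a ≤ h i + b →
  (∀ p → p ≢ i → g p ≤ h p) → ∑ g n + a ≤ ∑ h n + b
∑-change {suc n} {g} {h} a b zero gi≤hi g≤h = begin
  g zero + ∑ (g ∘ suc) n + a    ≡⟨ rotate (g zero) _ a ⟩
  g zero + a + ∑ (g ∘ suc) n    ≤⟨ +-mono-≤ gi≤hi (∑-monoˡ (λ p → g≤h (suc p) λ ()) n) ⟩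
  h zero + b + ∑ (h ∘ suc) n    ≡⟨ rotate (h zero) b _ ⟩
  h zero + ∑ (h ∘ suc) n + b    ∎
  where
  open ≤-Reasoning
  rotate : ∀ x y z → x + y + z ≡ x + z + y
  rotate x y z = trans (+-assoc x y z) (trans (cong (x +_) (+-comm y z)) (sym (+-assoc x z y)))
∑-change {suc n} {g} {h} a b (suc i) gi≤hi g≤h = begin
  g zero + ∑ (g ∘ suc) n + a    ≡⟨ +-assoc (g zero) _ a ⟩
  g zero + (∑ (g ∘ suc) n + a)  ≤⟨ +-mono-≤ (g≤h zero λ ()) (∑-change a b i gi≤hi
                                      (λ p p≢i → g≤h (suc p) (p≢i ∘ Finₚ.suc-injective))) ⟩
  h zero + (∑ (h ∘ suc) n + b)  ≡⟨ +-assoc (h zero) _ b ⟨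
  h zero + ∑ (h ∘ suc) n + b    ∎
  where open ≤-Reasoning

indicator : ∀ {p} {P : Set p} → Dec P → ℕ
indicator (yes _) = 1
indicator (no _)  = 0

indicator-true : ∀ {p} {P : Set p} (P? : Dec P) → P → indicator P? ≡ 1
indicator-true (yes _) _ = refl
indicator-true (no ¬p) p = contradiction p ¬p

indicator-false : ∀ {p} {P : Set p} (P? : Dec P) → ¬ P → indicator P? ≡ 0
indicator-false (yes p) ¬p = contradiction p ¬p
indicator-false (no _)  _  = refl

indicator≤1 : ∀ {p} {P : Set p} (P? : Dec P) → indicator P? ≤ 1
indicator≤1 (yes _) = s≤s z≤n
indicator≤1 (no _)  = z≤n

-- Updated and exchanged entries of vectors

module _ {a} {A : Set a} {n : ℕ} where

  updated : ∀ (xs : Vec A n) i x j →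
    (j ≡ i × lookup (xs [ i ]≔ x) j ≡ x) ⊎
    (j ≢ i × lookup (xs [ i ]≔ x) j ≡ lookup xs j)
  updated xs i x j with j Finₚ.≟ i
  ... | yes refl = inj₁ (refl , lookup∘update i xs x)
  ... | no  j≢i  = inj₂ (j≢i , lookup∘update′ j≢i xs x)

  lookup-exchange : ∀ (xs : Vec A n) i j k →
    lookup (xs [ i ]≔ lookup xs j [ j ]≔ lookup xs i) k ≡ lookup xs (transpose i j k)
  lookup-exchange xs i j k with k Finₚ.≟ i
  ... | yes refl with updated (xs [ k ]≔ lookup xs j) j (lookup xs k) k
  ...   | inj₁ (refl , eq) = eq
  ...   | inj₂ (_ , eq)    = trans eq (lookup∘update k xs (lookup xs j))
  lookup-exchange xs i j k | no k≢i with k Finₚ.≟ j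
  ...   | yes refl = lookup∘update k (xs [ i ]≔ lookup xs k) (lookup xs i)
  ...   | no  k≢j  = trans (lookup∘update′ k≢j (xs [ i ]≔ lookup xs j) (lookup xs i)) (lookup∘update′ k≢i xs (lookup xs j))

transpose-injective : ∀ {n} (i j : Fin n) {k l} → transpose i j k ≡ transpose i j l → k ≡ l
transpose-injective i j eq =
  trans (sym (transpose-inverse j i)) (trans (cong (transpose j i) eq) (transpose-inverse j i))

<suc-split : ∀ {n} {p q : Fin n} → toℕ q < suc (toℕ p) → toℕ q < toℕ p ⊎ q ≡ p
<suc-split {p = p} {q} (s≤s q≤p) with m≤n⇒m<n∨m≡n q≤p
... | inj₁ q<p = inj₁ q<p
... | inj₂ q≡p = inj₂ (toℕ-injective q≡p)

-- The entries of E are distinct 1-based addresses.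
record Addressing {n} (E : Vec ℕ n) : Set where
  field
    target   : ∀ p → ∃ λ (u : Fin n) → lookup E p ≡ suc (toℕ u)
    distinct : ∀ p q → lookup E p ≡ lookup E q → p ≡ q

-- Slots for leaders and repeats

-- Positions p have keys key p.  The slot of a leader is its key; the repeats get,
-- in ascending order, the slots that are not in the image.

module Slots {n : ℕ} (key : Fin n → Fin n) where

  Image : Fin n → Set
  Image u = ∃ λ p → key p ≡ u

  Leader Repeat : Fin n → Set
  Leader p = ∀ q → q Fin.< p → key q ≢ key p
  Repeat p = ∃ λ q → q Fin.< p × key q ≡ key p

  image? : ∀ u → Dec (Image u)
  image? u = any? (λ p → key p Finₚ.≟ u)

  leader-or-repeat : ∀ p → Leader p ⊎ Repeat p
  leader-or-repeat p with any? (λ q → (q Finₚ.<? p) ×-dec (key q Finₚ.≟ key p))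
  ... | yes r = inj₂ r
  ... | no ¬r = inj₁ λ q q<p eq → ¬r (q , q<p , eq)

  leader-of : ∀ {u} → Image u → ∃ λ p → Leader p × key p ≡ u
  leader-of im with least (λ p → key p Finₚ.≟ _) im
  ... | p , refl , lower = p , (λ q q<p eq → <⇒≱ q<p (lower q eq)) , refl

  leader≤ : ∀ {p q} → Leader p → key q ≡ key p → p Fin.≤ q
  leader≤ lead eq = ≮⇒≥ (λ q<p → lead _ q<p eq)

  leader-unique : ∀ {p q} → Leader p → Leader q → key p ≡ key q → p ≡ q
  leader-unique lp lq eq = Finₚ.≤-antisym (leader≤ lp (sym eq)) (leader≤ lq eq)

  leader≢repeat : ∀ {p q} → Leader p → Repeat q → p ≢ q
  leader≢repeat lead (r , r<p , eq) refl = lead r r<p eq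

  -- The first k positions have got their slots T, the repeats among them by
  -- using up the slots below l that are not in the image.  Slots are stored
  -- 1-based, and 0 stands for a slot that has not been assigned yet.
  record Assigned (k l : ℕ) (T : Vec ℕ n) : Set where
    field
      pending    : ∀ p → k ≤ toℕ p → lookup T p ≡ 0
      leaders    : ∀ p → toℕ p < k → Leader p → lookup T p ≡ suc (toℕ (key p))
      repeats    : ∀ p → toℕ p < k → Repeat p →
                   ∃ λ u → ¬ Image u × toℕ u < l × lookup T p ≡ suc (toℕ u)
      increasing : ∀ p q → p Fin.< q → toℕ q < k → Repeat p → Repeat q →
                   lookup T p < lookup T q
      used       : ∀ u → ¬ Image u → toℕ u < l →
                   ∃ λ p → toℕ p < k × Repeat p × lookup T p ≡ suc (toℕ u)

    slot≤n : ∀ p → lookup T p ≤ n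
    slot≤n p with toℕ p <? k
    ... | no p≮k = ≤-trans (≤-reflexive (pending p (≮⇒≥ p≮k))) z≤n
    ... | yes p<k with leader-or-repeat p
    ...   | inj₁ lead = ≤-trans (≤-reflexive (leaders p p<k lead)) (toℕ<n (key p))
    ...   | inj₂ rep with repeats p p<k rep
    ...     | u , _ , _ , eq = ≤-trans (≤-reflexive eq) (toℕ<n u)

  open Assigned

  none-assigned : ∀ {T} → (∀ p → lookup T p ≡ 0) → Assigned 0 0 T
  none-assigned T≡0 = record
    { pending = λ p _ → T≡0 p ; leaders = λ _ () ; repeats = λ _ ()
    ; increasing = λ _ _ _ () ; used = λ _ _ () }

  skip-slot : ∀ {k T} u → Image u → Assigned k (toℕ u) T → Assigned k (suc (toℕ u)) T
  skip-slot u im A = record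
    { pending = pending A ; leaders = leaders A ; increasing = increasing A
    ; repeats = λ p p<k rep → case repeats A p p<k rep of λ
        { (w , ¬im , w<u , eq) → w , ¬im , m<n⇒m<1+n w<u , eq }
    ; used = λ w ¬im w≤u → case <suc-split w≤u of λ
        { (inj₁ w<u) → used A w ¬im w<u ; (inj₂ refl) → contradiction im ¬im } }

  module _ {l : ℕ} {T : Vec ℕ n} (p : Fin n) (A : Assigned (toℕ p) l T) where

    private
      T′ : ℕ → Vec ℕ n
      T′ t = T [ p ]≔ t

      old : ∀ t q → toℕ q < toℕ p → lookup (T′ t) q ≡ lookup T q
      old t q q<p = lookup∘update′ (λ q≡p → <⇒≢ q<p (cong toℕ q≡p)) T t

      new : ∀ t → lookup (T′ t) p ≡ t
      new = lookup∘update p T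

      pending′ : ∀ t q → suc (toℕ p) ≤ toℕ q → lookup (T′ t) q ≡ 0
      pending′ t q p<q = trans
        (lookup∘update′ (λ q≡p → <⇒≢ p<q (sym (cong toℕ q≡p))) T t) (pending A q (<⇒≤ p<q))

    place-leader : Leader p → Assigned (suc (toℕ p)) l (T′ (suc (toℕ (key p))))
    place-leader lead = record
      { pending = pending′ t
      ; leaders = λ q q≤p lq → case <suc-split q≤p of λ
          { (inj₁ q<p) → trans (old t q q<p) (leaders A q q<p lq) ; (inj₂ refl) → new t }
      ; repeats = λ q q≤p rq → case <suc-split q≤p of λ
          { (inj₁ q<p) → case repeats A q q<p rq of λ
              { (u , ¬im , u<l , eq) → u , ¬im , u<l , trans (old t q q<p) eq }
          ; (inj₂ refl) → contradiction refl (leader≢repeat lead rq) }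
      ; increasing = λ q r q<r r≤p rq rr → case <suc-split r≤p of λ
          { (inj₁ r<p) → subst₂ _<_ (sym (old t q (<-trans q<r r<p))) (sym (old t r r<p))
                           (increasing A q r q<r r<p rq rr)
          ; (inj₂ refl) → contradiction refl (leader≢repeat lead rr) }
      ; used = λ u ¬im u<l → case used A u ¬im u<l of λ
          { (q , q<p , rq , eq) → q , m<n⇒m<1+n q<p , rq , trans (old t q q<p) eq } }
      where t = suc (toℕ (key p))

    place-repeat : ∀ u → toℕ u ≡ l → ¬ Image u → Repeat p →
      Assigned (suc (toℕ p)) (suc l) (T′ (suc (toℕ u)))
    place-repeat u refl ¬imᵤ rep = record
      { pending = pending′ t
      ; leaders = λ q q≤p lq → case <suc-split q≤p of λ
          { (inj₁ q<p) → trans (old t q q<p) (leaders A q q<p lq)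
          ; (inj₂ refl) → contradiction refl (leader≢repeat lq rep) }
      ; repeats = λ q q≤p rq → case <suc-split q≤p of λ
          { (inj₁ q<p) → case repeats A q q<p rq of λ
              { (w , ¬im , w<l , eq) → w , ¬im , m<n⇒m<1+n w<l , trans (old t q q<p) eq }
          ; (inj₂ refl) → u , ¬imᵤ , ≤-refl , new t }
      ; increasing = λ q r q<r r≤p rq rr → case <suc-split r≤p of λ
          { (inj₁ r<p) → subst₂ _<_ (sym (old t q (<-trans q<r r<p))) (sym (old t r r<p))
                           (increasing A q r q<r r<p rq rr)
          ; (inj₂ refl) → case repeats A q q<r rq of λ
              { (w , _ , w<l , eq) → subst₂ _<_ (sym (trans (old t q q<r) eq)) (sym (new t)) (s≤s w<l) } }
      ; used = λ w ¬im w≤u → case <suc-split w≤u of λ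
          { (inj₁ w<u) → case used A w ¬im w<u of λ
              { (q , q<p , rq , eq) → q , m<n⇒m<1+n q<p , rq , trans (old t q q<p) eq }
          ; (inj₂ refl) → p , ≤-refl , rep , new t } }
      where t = suc (toℕ u)

    -- If no slot were left for p, then all n slots would belong to the n - 1
    -- other positions.
    slot-left : Repeat p → l ≢ n
    slot-left rep refl = case injective⇒surjective (λ u → proj₁ (owner u)) owner-inj p of λ
      { (u , eq) → proj₁ (proj₂ (owner u)) eq }
      where
      Owns : Fin n → Fin n → Set
      Owns q u = (Leader q × key q ≡ u) ⊎ (Repeat q × ¬ Image u × lookup T q ≡ suc (toℕ u))

      -- A slot in the image belongs to the leader of its key, whether or not
      -- that leader has been reached yet.
      owner : ∀ u → ∃ λ q → q ≢ p × Owns q u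
      owner u with image? u
      ... | yes im = case leader-of im of λ
              { (q , lead , eq) → q , leader≢repeat lead rep , inj₁ (lead , eq) }
      ... | no ¬im = case used A u ¬im (toℕ<n u) of λ
              { (q , q<p , rq , eq) → q , (λ q≡p → <⇒≢ q<p (cong toℕ q≡p)) , inj₂ (rq , ¬im , eq) }

      functional : ∀ {q u w} → Owns q u → Owns q w → u ≡ w
      functional (inj₁ (_ , refl)) (inj₁ (_ , refl)) = refl
      functional (inj₁ (lead , _)) (inj₂ (rep , _)) = contradiction refl (leader≢repeat lead rep)
      functional (inj₂ (rep , _)) (inj₁ (lead , _)) = contradiction refl (leader≢repeat lead rep)
      functional (inj₂ (_ , _ , eq)) (inj₂ (_ , _ , eq′)) =
        toℕ-injective (suc-injective (trans (sym eq) eq′))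

      owner-inj : Injective _≡_ _≡_ (λ u → proj₁ (owner u))
      owner-inj {u} {w} eq = functional (proj₂ (proj₂ (owner u)))
        (subst (λ q → Owns q w) (sym eq) (proj₂ (proj₂ (owner w))))

  -- Slots and marks in one array

  two-marks : 2 * suc n ≡ suc (suc (n + n))
  two-marks = cong suc (trans (+-suc n (n + 0)) (cong (λ x → suc (n + x)) (+-identityʳ n)))

  -- Mark k u m: m tells whether u is outside the image (0), in the image but
  -- without a position below k of that key (1), or with such a position (2).
  data Mark (k : ℕ) (u : Fin n) : ℕ → Set where
    blank : ¬ Image u → Mark k u 0
    fresh : Image u → (∀ q → toℕ q < k → key q ≢ u) → Mark k u 1
    seen  : ∀ q → toℕ q < k → key q ≡ u → Mark k u 2

  -- The premise excludes that p turns the mark of its key from fresh to seen.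
  mark-next : ∀ p {u m} → (key p ≡ u → ∃ λ q → toℕ q < toℕ p × key q ≡ u) →
    Mark (toℕ p) u m → Mark (suc (toℕ p)) u m
  mark-next p again (blank ¬im)     = blank ¬im
  mark-next p again (seen q q<p eq) = seen q (m<n⇒m<1+n q<p) eq
  mark-next p again (fresh im unseen) = fresh im λ q q≤p eq → case <suc-split q≤p of λ
    { (inj₁ q<p) → unseen q q<p eq
    ; (inj₂ refl) → case again eq of λ { (r , r<p , eq′) → unseen r r<p eq′ } }

  -- E holds slots and marks at the same time, the marks as multiples of n + 1.
  record Coded (k l : ℕ) (E : Vec ℕ n) : Set where
    field
      {slots}  : Vec ℕ n
      assigned : Assigned k l slots
      code     : ∀ u → ∃ λ m → Mark k u m × lookup E u ≡ lookup slots u + m * suc n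

  open Coded

  code-bound : ∀ {k u t m} → t ≤ n → Mark k u m → t + m * suc n ≤ suc (suc (n + (n + n)))
  code-bound {t = t} {m} t≤n mark = begin
    t + m * suc n            ≤⟨ +-mono-≤ t≤n (*-monoˡ-≤ (suc n) (m≤2 mark)) ⟩
    n + 2 * suc n            ≡⟨ cong (n +_) two-marks ⟩
    n + suc (suc (n + n))    ≡⟨ trans (+-suc n _) (cong suc (+-suc n _)) ⟩
    suc (suc (n + (n + n)))  ∎
    where
    open ≤-Reasoning
    m≤2 : ∀ {k u m} → Mark k u m → m ≤ 2
    m≤2 (blank _)    = z≤n
    m≤2 (fresh _ _)  = s≤s z≤n
    m≤2 (seen _ _ _) = ≤-refl

  coded-bound : ∀ {k l E} → Coded k l E → ∀ u → lookup E u ≤ suc (suc (n + (n + n)))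
  coded-bound C u with code C u
  ... | _ , mark , eq = ≤-trans (≤-reflexive eq) (code-bound (Assigned.slot≤n (assigned C) u) mark)

  module _ {l : ℕ} {E : Vec ℕ n} (p : Fin n) (C : Coded (toℕ p) l E) where

    private
      slot-set : ∀ t {m} → lookup E p ≡ lookup (slots C) p + m * suc n → lookup E p + t ≡ t + m * suc n
      slot-set t {m} eq = trans (cong (_+ t) (trans eq (cong (_+ m * suc n) (pending (assigned C) p ≤-refl))))
                                (+-comm (m * suc n) t)

    -- The slot of p is still 0, so that adding t to entry p stores the slot t there
    -- and keeps the mark.
    claim-bound : ∀ t → t ≤ n → lookup E p + t ≤ suc (suc (n + (n + n)))
    claim-bound t t≤n with code C p
    ... | m , mark , eq = ≤-trans (≤-reflexive (slot-set t {m} eq)) (code-bound t≤n mark)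

    claim : ∀ t u → ∃ λ m → Mark (toℕ p) u m ×
      lookup (E [ p ]≔ (lookup E p + t)) u ≡ lookup (slots C [ p ]≔ t) u + m * suc n
    claim t u with code C u | updated E p (lookup E p + t) u
    ... | m , mark , eq | inj₁ (refl , eq′) = m , mark ,
      trans eq′ (trans (slot-set t {m} eq) (cong (_+ m * suc n) (sym (lookup∘update p (slots C) t))))
    ... | m , mark , eq | inj₂ (u≢p , eq′) = m , mark ,
      trans eq′ (trans eq (cong (_+ m * suc n) (sym (lookup∘update′ u≢p (slots C) t))))

    code-repeat : ∀ u → toℕ u ≡ l → ¬ Image u → Repeat p →
      Coded (suc (toℕ p)) (suc l) (E [ p ]≔ (lookup E p + suc (toℕ u)))
    code-repeat u u≡l ¬im rep@(q , q<p , eq) = record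
      { assigned = place-repeat p (assigned C) u u≡l ¬im rep
      ; code = λ w → case claim (suc (toℕ u)) w of λ
          { (m , mark , eq′) → m , mark-next p (λ { refl → q , q<p , eq }) mark , eq′ } }

    -- The second update turns the mark of key p from 1 to 2.
    code-leader : (∀ q → toℕ q < toℕ p → key q ≢ key p) →
      let E₁ = E [ p ]≔ (lookup E p + suc (toℕ (key p))) in
      Coded (suc (toℕ p)) l (E₁ [ key p ]≔ (lookup E₁ (key p) + suc n))
    code-leader lead = record { assigned = place-leader p (assigned C) lead ; code = code′ }
      where
      t  = suc (toℕ (key p))
      E₁ = E [ p ]≔ (lookup E p + t)
      T′ = slots C [ p ]≔ t
      code′ : ∀ u → ∃ λ m → Mark (suc (toℕ p)) u m ×
        lookup (E₁ [ key p ]≔ (lookup E₁ (key p) + suc n)) u ≡ lookup T′ u + m * suc n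
      code′ u with updated E₁ (key p) (lookup E₁ (key p) + suc n) u | claim t u
      ... | inj₂ (u≢v , eq) | m , mark , eq′ =
        m , mark-next p (λ v≡u → contradiction (sym v≡u) u≢v) mark , trans eq eq′
      ... | inj₁ (refl , eq) | _ , blank ¬im , _ = contradiction (p , refl) ¬im
      ... | inj₁ (refl , eq) | _ , seen q q<p eq′ , _ = contradiction eq′ (lead q q<p)
      ... | inj₁ (refl , eq) | _ , fresh _ _ , eq′ = 2 , seen p ≤-refl refl ,
        trans eq (trans (cong (_+ suc n) eq′) (trans (+-assoc (lookup T′ u) _ (suc n))
          (cong (λ x → lookup T′ u + x) (+-comm (1 * suc n) (suc n)))))

  code-skip : ∀ {k E} u → Image u → Coded k (toℕ u) E → Coded k (suc (toℕ u)) E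
  code-skip u im C = record { assigned = skip-slot u im (assigned C) ; code = code C }

  assigned-cong : ∀ {k l T T′} → (∀ u → lookup T u ≡ lookup T′ u) → Assigned k l T → Assigned k l T′
  assigned-cong {k} {l} eq = subst (Assigned k l) (vec-ext eq)

  -- The slot of a leader is in the image, that of a repeat is not.
  distinct-slots : ∀ {l T} → Assigned n l T → ∀ p q → lookup T p ≡ lookup T q → p ≡ q
  distinct-slots A p q eq with leader-or-repeat p | leader-or-repeat q
  ... | inj₁ lp | inj₁ lq = leader-unique lp lq (toℕ-injective (suc-injective
          (trans (sym (leaders A p (toℕ<n p) lp)) (trans eq (leaders A q (toℕ<n q) lq)))))
  ... | inj₁ lp | inj₂ rq with repeats A q (toℕ<n q) rq
  ...   | u , ¬im , _ , eq′ = contradiction (p , toℕ-injective (suc-injective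
          (trans (sym (leaders A p (toℕ<n p) lp)) (trans eq eq′)))) ¬im
  distinct-slots A p q eq | inj₂ rp | inj₁ lq with repeats A p (toℕ<n p) rp
  ...   | u , ¬im , _ , eq′ = contradiction (q , toℕ-injective (suc-injective
          (trans (sym (leaders A q (toℕ<n q) lq)) (trans (sym eq) eq′)))) ¬im
  distinct-slots A p q eq | inj₂ rp | inj₂ rq with Finₚ.<-cmp p q
  ... | tri< p<q _ _ = contradiction eq (<⇒≢ (increasing A p q p<q (toℕ<n q) rp rq))
  ... | tri≈ _ p≡q _ = p≡q
  ... | tri> _ _ q<p = contradiction (sym eq) (<⇒≢ (increasing A q p q<p (toℕ<n p) rq rp))

  addressing : ∀ {l T} → Assigned n l T → Addressing T
  addressing A = record { distinct = distinct-slots A ; target = target }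
    where
    target : ∀ p → _
    target p with leader-or-repeat p
    ... | inj₁ lead = key p , leaders A p (toℕ<n p) lead
    ... | inj₂ rep with repeats A p (toℕ<n p) rep
    ...   | u , _ , _ , eq = u , eq

-- Arrays in which each occurring key v has its first item at position v

-- d is an arrangement of the items.  A position u with f (d u) ≡ u is occupied
-- by the first item with key u; the items in all other positions are in their
-- original order.
record Grouped {n} (f : Fin n → Fin n) (d : Vec (Fin n) n) : Set where
  key : Fin n → Fin n
  key u = f (lookup d u)
  field
    injective   : ∀ u w → lookup d u ≡ lookup d w → u ≡ w
    idempotent  : ∀ u → key (key u) ≡ key u
    first-leads : ∀ u → key u ≢ u → lookup d (key u) Fin.< lookup d u
    in-order    : ∀ u w → key u ≢ u → key w ≢ w → u Fin.< w → lookup d u Fin.< lookup d w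

-- at-slot says that each item of d is at its slot.  The keys of the positions in
-- the original arrangement are given by g.
module _ {n : ℕ} {f g : Fin n → Fin n} {d : Vec (Fin n) n} {T : Vec ℕ n} {l : ℕ}
         (g≗f : ∀ p → g p ≡ f p) (A : Slots.Assigned g n l T)
         (at-slot : ∀ u → lookup T (lookup d u) ≡ suc (toℕ u)) where
  open Slots g
  open Assigned A

  private
    key : Fin n → Fin n
    key u = f (lookup d u)

    repeated : ∀ u → key u ≢ u → Repeat (lookup d u)
    repeated u moved with leader-or-repeat (lookup d u)
    ... | inj₂ rep  = rep
    ... | inj₁ lead = contradiction (trans (sym (g≗f (lookup d u))) (toℕ-injective (suc-injective
      (trans (sym (leaders _ (toℕ<n (lookup d u)) lead)) (at-slot u))))) moved

    leader-at : ∀ u → ∃ λ q → Leader q × g q ≡ key u × lookup d (key u) ≡ q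
    leader-at u with leader-of (lookup d u , g≗f (lookup d u))
    ... | q , lead , eq = q , lead , eq , distinct-slots A _ _
      (trans (at-slot (key u)) (sym (trans (leaders q (toℕ<n q) lead) (cong (suc ∘ toℕ) eq))))

  grouped : Grouped f d
  grouped = record
    { injective = λ u w eq → toℕ-injective (suc-injective
        (trans (sym (at-slot u)) (trans (cong (lookup T) eq) (at-slot w))))
    ; idempotent = λ u → case leader-at u of λ
        { (q , _ , eq , at) → trans (cong f at) (trans (sym (g≗f q)) eq) }
    ; first-leads = λ u moved → case leader-at u of λ
        { (q , lead , eq , at) → case repeated u moved of λ
          { (r , r<u , eq′) → subst (Fin._< lookup d u) (sym at)
              (≤-<-trans (leader≤ lead (trans eq′ (trans (g≗f _) (sym eq)))) r<u) } }
    ; in-order = λ u w u-moved w-moved u<w → case Finₚ.<-cmp (lookup d u) (lookup d w) of λ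
        { (tri< lt _ _) → lt
        ; (tri≈ _ eq _) → contradiction
            (suc-injective (trans (sym (at-slot u)) (trans (cong (lookup T) eq) (at-slot w)))) (<⇒≢ u<w)
        ; (tri> _ _ gt) → contradiction
            (increasing _ _ gt (toℕ<n _) (repeated w w-moved) (repeated u u-moved))
            (<⇒≯ (subst₂ _<_ (sym (at-slot u)) (sym (at-slot w)) (s≤s u<w))) } }

-- Ranks by counting

module Ranks {n : ℕ} (key : Fin n → Fin n) where

  -- The number of positions below k with key u.
  occ : ℕ → Fin n → ℕ
  occ k u = ∑ (λ p → indicator (key p Finₚ.≟ u)) k

  occ-hit : ∀ p → occ (suc (toℕ p)) (key p) ≡ suc (occ (toℕ p) (key p))
  occ-hit p = trans (∑-suc _ p)
    (trans (cong (occ (toℕ p) (key p) +_) (indicator-true (key p Finₚ.≟ key p) refl)) (+-comm _ 1))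

  occ-miss : ∀ p u → key p ≢ u → occ (suc (toℕ p)) u ≡ occ (toℕ p) u
  occ-miss p u ≢u = trans (∑-suc _ p)
    (trans (cong (occ (toℕ p) u +_) (indicator-false (key p Finₚ.≟ u) ≢u)) (+-identityʳ _))

  occ-total : ∀ k → k ≤ n → ∑ (occ k) n ≤ k
  occ-total zero    _   = subst (∑ (occ 0) n ≤_) (*-zeroʳ n) (∑-bound (λ _ → z≤n) n)
  occ-total (suc k) k<n with fromℕ< k<n | toℕ-fromℕ< k<n
  ... | p | refl = begin
    ∑ (occ (suc k)) n      ≡⟨ +-identityʳ _ ⟨
    ∑ (occ (suc k)) n + 0  ≤⟨ ∑-change 0 1 (key p)
                                (≤-reflexive (trans (+-identityʳ _) (trans (occ-hit p) (+-comm 1 _))))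
                                (λ u u≢ → ≤-reflexive (occ-miss p u (u≢ ∘ sym))) ⟩
    ∑ (occ k) n + 1        ≡⟨ +-comm _ 1 ⟩
    suc (∑ (occ k) n)      ≤⟨ s≤s (occ-total k (<⇒≤ k<n)) ⟩
    suc k                  ∎
    where open ≤-Reasoning

  occ≤n : ∀ p u → occ (suc (toℕ p)) u ≤ n
  occ≤n p u = ≤-trans (∑-bound (λ q → indicator≤1 (key q Finₚ.≟ u)) (suc (toℕ p)))
    (≤-trans (≤-reflexive (*-identityʳ _)) (toℕ<n p))

  -- The number of positions with key below k.  The positions with key u get the
  -- ranks from start (toℕ u) + 1 to start (suc (toℕ u)).
  start : ℕ → ℕ
  start = ∑ (occ n)

  start≤n : ∀ u → start (suc (toℕ u)) ≤ n
  start≤n u = ≤-trans (∑-monoʳ (occ n) {l = n} (toℕ<n u)) (occ-total n ≤-refl)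

  -- The contents E of the auxiliary array after the positions from k on have been
  -- visited, in descending order.  A position v with key v ≡ v holds the counter of
  -- key v: start (toℕ v) plus the number of unvisited positions with key v, where v
  -- itself always counts as unvisited.  The other visited positions hold
  -- their ranks.
  record Ranked (k : ℕ) (E : Vec ℕ n) : Set where
    field
      capped    : ∀ v → key v ≡ v → lookup E v ≤ start (suc (toℕ v))
      waiting   : ∀ v → key v ≡ v → toℕ v < k → lookup E v ≡ start (toℕ v) + occ k v
      visited   : ∀ v → key v ≡ v → k ≤ toℕ v → lookup E v ≡ suc (start (toℕ v) + occ k v)
      window    : ∀ p → key p ≢ p → k ≤ toℕ p →
                  lookup E (key p) < lookup E p × lookup E p ≤ start (suc (toℕ (key p)))
      ascending : ∀ p q → key p ≢ p → key q ≢ q → k ≤ toℕ p → p Fin.< q → key p ≡ key q →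
                  lookup E p < lookup E q

  open Ranked

  unranked : ∀ {E} → (∀ u → lookup E u ≡ start (suc (toℕ u))) → Ranked n E
  unranked E≡ = record
    { capped    = λ v _ → ≤-reflexive (E≡ v)
    ; waiting   = λ v _ _ → trans (E≡ v) (∑-suc (occ n) v)
    ; visited   = λ v _ n≤v → contradiction (toℕ<n v) (≤⇒≯ n≤v)
    ; window    = λ p _ n≤p → contradiction (toℕ<n p) (≤⇒≯ n≤p)
    ; ascending = λ p _ _ _ n≤p → contradiction (toℕ<n p) (≤⇒≯ n≤p) }

  rank-fixed : ∀ p {E} → key p ≡ p → Ranked (suc (toℕ p)) E → Ranked (toℕ p) E
  rank-fixed p {E} fix R = record
    { capped = capped R
    ; waiting = λ v fv v<p → trans (waiting R v fv (m<n⇒m<1+n v<p))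
        (cong (start (toℕ v) +_) (occ-miss p v (λ eq → <⇒≢ v<p (cong toℕ (trans (sym eq) fix)))))
    ; visited = λ v fv p≤v → case m≤n⇒m<n∨m≡n p≤v of λ
        { (inj₁ p<v) → trans (visited R v fv p<v) (cong (λ o → suc (start (toℕ v) + o))
            (occ-miss p v (λ eq → <⇒≢ p<v (cong toℕ (trans (sym fix) eq)))))
        ; (inj₂ p≡v) → case toℕ-injective p≡v of λ { refl →
            trans (waiting R p fix ≤-refl) (trans (cong (start (toℕ p) +_)
              (subst (λ v → occ (suc (toℕ p)) v ≡ suc (occ (toℕ p) v)) fix (occ-hit p)))
              (+-suc _ _)) } }
    ; window = λ q mq p≤q → window R q mq (later mq p≤q)
    ; ascending = λ q r mq mr p≤q → ascending R q r mq mr (later mq p≤q) }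
    where
    later : ∀ {q} → key q ≢ q → toℕ p ≤ toℕ q → suc (toℕ p) ≤ toℕ q
    later mq p≤q = ≤∧≢⇒< p≤q (λ eq → mq (subst (λ q → key q ≡ q) (toℕ-injective eq) fix))

  module _ (idempotent : ∀ u → key (key u) ≡ key u) where

    private
      fixed≢moved : ∀ {v p} → key v ≡ v → key p ≢ p → v ≢ p
      fixed≢moved fv mp refl = mp fv

    -- The counter of the leader of p is positive.
    counter : ∀ p {E} → Ranked (suc (toℕ p)) E → ∃ λ x → lookup E (key p) ≡ suc x
    counter p R with toℕ (key p) <? suc (toℕ p)
    ... | no  p<v = _ , visited R (key p) (idempotent p) (≮⇒≥ p<v)
    ... | yes v<p = _ , trans (waiting R (key p) (idempotent p) v<p)
                          (trans (cong (start (toℕ (key p)) +_) (occ-hit p)) (+-suc _ _))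

    rank-moved : ∀ p {E x} → key p ≢ p → Ranked (suc (toℕ p)) E → lookup E (key p) ≡ suc x →
      Ranked (toℕ p) (E [ p ]≔ lookup E (key p) [ key p ]≔ x)
    rank-moved p {E} {x} mp R Ev≡ = record
      { capped = λ w fw → case updated E₁ v x w of λ
          { (inj₁ (refl , eq)) → ≤-trans (≤-reflexive eq)
              (≤-trans (n≤1+n x) (≤-trans (≤-reflexive (sym Ev≡)) (capped R v (idempotent p))))
          ; (inj₂ (w≢v , eq)) → ≤-trans (≤-reflexive (trans eq (E₁-fixed fw))) (capped R w fw) }
      ; waiting = λ w fw w<p → case updated E₁ v x w of λ
          { (inj₁ (refl , eq)) → trans eq (suc-injective (trans (sym Ev≡)
              (trans (waiting R v fw (m<n⇒m<1+n w<p)) (trans (cong (start (toℕ v) +_) (occ-hit p)) (+-suc _ _)))))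
          ; (inj₂ (w≢v , eq)) → trans eq (trans (E₁-fixed fw)
              (trans (waiting R w fw (m<n⇒m<1+n w<p)) (cong (start (toℕ w) +_) (occ-miss p w (w≢v ∘ sym))))) }
      ; visited = λ w fw p≤w → case updated E₁ v x w of λ
          { (inj₁ (refl , eq)) → trans eq (suc-injective (trans (sym Ev≡)
              (trans (visited R v fw (after (fixed≢moved fw mp) p≤w))
                (cong suc (trans (cong (start (toℕ v) +_) (occ-hit p)) (+-suc _ _))))))
          ; (inj₂ (w≢v , eq)) → trans eq (trans (E₁-fixed fw)
              (trans (visited R w fw (after (fixed≢moved fw mp) p≤w))
                (cong (λ o → suc (start (toℕ w) + o)) (occ-miss p w (w≢v ∘ sym))))) }
      ; window = λ q mq p≤q → subst₂ _<_ refl (sym (E′-moved q mq)) (below-counter q mq p≤q)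
                            , subst (_≤ _) (sym (E′-moved q mq)) (capped₁ q mq p≤q)
      ; ascending = λ q r mq mr p≤q q<r eq →
          subst₂ _<_ (sym (E′-moved q mq)) (sym (E′-moved r mr)) (ascending₁ q r mq mr p≤q q<r eq) }
      where
      v  = key p
      E₁ = E [ p ]≔ lookup E v
      E′ = E₁ [ v ]≔ x

      after : ∀ {q} → q ≢ p → toℕ p ≤ toℕ q → suc (toℕ p) ≤ toℕ q
      after q≢p p≤q = ≤∧≢⇒< p≤q (λ eq → q≢p (sym (toℕ-injective eq)))

      E₁-fixed : ∀ {w} → key w ≡ w → lookup E₁ w ≡ lookup E w
      E₁-fixed fw = lookup∘update′ (fixed≢moved fw mp) E _

      E′-moved : ∀ q → key q ≢ q → lookup E′ q ≡ lookup E₁ q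
      E′-moved q mq = lookup∘update′ (fixed≢moved (idempotent p) mq ∘ sym) E₁ x

      E′≤E : ∀ {w} → key w ≡ w → lookup E′ w ≤ lookup E w
      E′≤E {w} fw with updated E₁ v x w
      ... | inj₁ (refl , eq) = ≤-trans (≤-reflexive eq) (≤-trans (n≤1+n x) (≤-reflexive (sym Ev≡)))
      ... | inj₂ (_ , eq)    = ≤-reflexive (trans eq (E₁-fixed fw))

      below-counter : ∀ q → key q ≢ q → toℕ p ≤ toℕ q → lookup E′ (key q) < lookup E₁ q
      below-counter q mq p≤q with updated E p (lookup E v) q
      ... | inj₁ (refl , eq) = ≤-reflexive (trans (cong suc (lookup∘update v E₁ x)) (trans (sym Ev≡) (sym eq)))
      ... | inj₂ (q≢p , eq)  = ≤-<-trans (E′≤E (idempotent q))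
              (subst (_ <_) (sym eq) (proj₁ (window R q mq (after q≢p p≤q))))

      capped₁ : ∀ q → key q ≢ q → toℕ p ≤ toℕ q → lookup E₁ q ≤ start (suc (toℕ (key q)))
      capped₁ q mq p≤q with updated E p (lookup E v) q
      ... | inj₁ (refl , eq) = ≤-trans (≤-reflexive eq) (capped R v (idempotent p))
      ... | inj₂ (q≢p , eq)  = ≤-trans (≤-reflexive eq) (proj₂ (window R q mq (after q≢p p≤q)))

      ascending₁ : ∀ q r → key q ≢ q → key r ≢ r → toℕ p ≤ toℕ q → q Fin.< r → key q ≡ key r →
        lookup E₁ q < lookup E₁ r
      ascending₁ q r mq mr p≤q q<r eq
        with updated E p (lookup E v) q | updated E p (lookup E v) r
      ... | _ | inj₁ (refl , _) = contradiction q<r (≤⇒≯ p≤q)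
      ... | inj₁ (refl , eq₁) | inj₂ (_ , eq₂) = subst₂ _<_
              (sym (trans eq₁ (cong (lookup E) eq))) (sym eq₂) (proj₁ (window R r mr q<r))
      ... | inj₂ (q≢p , eq₁) | inj₂ (_ , eq₂) =
              subst₂ _<_ (sym eq₁) (sym eq₂) (ascending R q r mq mr (after q≢p p≤q) q<r eq)

    -- When all positions have been visited, the counter of v is start (toℕ v) + 1,
    -- the rank of position v.
    module _ {E : Vec ℕ n} (R : Ranked 0 E) where

      rank-lower : ∀ p → start (toℕ (key p)) < lookup E p
      rank-lower p with key p Finₚ.≟ p
      ... | yes fp = ≤-<-trans (≤-reflexive (cong (start ∘ toℕ) fp))
              (subst (start (toℕ p) <_) (sym (visited R p fp z≤n)) (s≤s (m≤m+n _ _)))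
      ... | no  mp = <-trans (subst (start (toℕ (key p)) <_) (sym (visited R _ (idempotent p) z≤n)) (s≤s (m≤m+n _ _)))
                             (proj₁ (window R p mp z≤n))

      rank-upper : ∀ p → lookup E p ≤ start (suc (toℕ (key p)))
      rank-upper p with key p Finₚ.≟ p
      ... | yes fp = subst (λ v → lookup E p ≤ start (suc (toℕ v))) (sym fp) (capped R p fp)
      ... | no  mp = proj₂ (window R p mp z≤n)

      rank-by-key : ∀ p q → key p Fin.< key q → lookup E p < lookup E q
      rank-by-key p q p<q =
        ≤-<-trans (rank-upper p) (≤-<-trans (∑-monoʳ (occ n) p<q) (rank-lower q))

-- E gives the ranks of the positions of d in the stable order.
record StableRanks {n} (f : Fin n → Fin n) (d : Vec (Fin n) n) (E : Vec ℕ n) : Set where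
  field
    addresses : Addressing E
    by-key    : ∀ p q → f (lookup d p) Fin.< f (lookup d q) → lookup E p < lookup E q
    by-index  : ∀ p q → f (lookup d p) ≡ f (lookup d q) → lookup d p Fin.< lookup d q →
                lookup E p < lookup E q

module _ {n : ℕ} {f : Fin n → Fin n} {d : Vec (Fin n) n} (G : Grouped f d) where
  open Grouped G
  open Ranks key

  stable-ranks : ∀ {E} → Ranked 0 E → StableRanks f d E
  stable-ranks {E} R = record
    { addresses = record { target = target ; distinct = distinct }
    ; by-key = rank-by-key idempotent R ; by-index = by-index }
    where
    by-index : ∀ p q → key p ≡ key q → lookup d p Fin.< lookup d q → lookup E p < lookup E q
    by-index p q eq dp<dq with key p Finₚ.≟ p | key q Finₚ.≟ q
    ... | yes fp | yes fq = contradiction (cong (lookup d) (trans (sym fp) (trans eq fq)))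
                              (λ e → <⇒≢ dp<dq (cong toℕ e))
    ... | yes fp | no  mq = subst (λ v → lookup E v < lookup E q) (trans (sym eq) fp)
                              (proj₁ (Ranked.window R q mq z≤n))
    ... | no  mp | yes fq = contradiction dp<dq (<⇒≯
                              (subst (λ v → lookup d v Fin.< lookup d p) (trans eq fq) (first-leads p mp)))
    ... | no  mp | no  mq with Finₚ.<-cmp p q
    ...   | tri< p<q _ _ = Ranked.ascending R p q mp mq z≤n p<q eq
    ...   | tri≈ _ refl _ = contradiction refl (<⇒≢ dp<dq)
    ...   | tri> _ _ q<p = contradiction dp<dq (<⇒≯ (in-order q p mq mp q<p))

    target : ∀ p → ∃ λ u → lookup E p ≡ suc (toℕ u)
    target p with lookup E p | rank-lower idempotent R p | ≤-trans (rank-upper idempotent R p) (start≤n (key p))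
    ... | suc r | _ | r<n = fromℕ< r<n , cong suc (sym (toℕ-fromℕ< r<n))

    distinct : ∀ p q → lookup E p ≡ lookup E q → p ≡ q
    distinct p q eq with Finₚ.<-cmp (key p) (key q)
    ... | tri< lt _ _ = contradiction eq (<⇒≢ (rank-by-key idempotent R p q lt))
    ... | tri> _ _ gt = contradiction (sym eq) (<⇒≢ (rank-by-key idempotent R q p gt))
    ... | tri≈ _ same _ with Finₚ.<-cmp (lookup d p) (lookup d q)
    ...   | tri< lt _ _ = contradiction eq (<⇒≢ (by-index p q same lt))
    ...   | tri≈ _ e _  = injective p q e
    ...   | tri> _ _ gt = contradiction (sym eq) (<⇒≢ (by-index q p (sym same) gt))

-- d′ is the arrangement d with each item moved to the address that E gives for it.
Arranged : ∀ {n} (d : Vec (Fin n) n) (E : Vec ℕ n) (d′ : Vec (Fin n) n) → Set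
Arranged {n} d E d′ = ∀ u → ∃ λ p → lookup E p ≡ suc (toℕ u) × lookup d′ u ≡ lookup d p

-- Positions compare like ranks, hence first by key and then by original index.
stably-sorted : ∀ {n} {f : Fin n → Fin n} {d E d′} → (∀ u w → lookup d u ≡ lookup d w → u ≡ w) →
  StableRanks f d E → Arranged d E d′ → StablySorted f d′
stably-sorted {n} {f} {d} {E} {d′} d-inj S arranged = record
  { rearranged = (λ {u} {w} → inj {u} {w}) , λ y → case injective⇒surjective (lookup d′) inj y of λ
      { (u , eq) → u , λ { refl → eq } }
  ; sorted = sorted ; stable = stable }
  where
  open StableRanks S
  inj : Injective _≡_ _≡_ (lookup d′)
  inj {u} {w} eq with arranged u | arranged w
  ... | p , Ep , dp | q , Eq , dq with d-inj p q (trans (sym dp) (trans eq dq))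
  ...   | refl = toℕ-injective (suc-injective (trans (sym Ep) Eq))

  sorted : ∀ u w → u Fin.≤ w → f (lookup d′ u) Fin.≤ f (lookup d′ w)
  sorted u w u≤w with arranged u | arranged w
  ... | p , Ep , dp | q , Eq , dq = ≮⇒≥ λ lt →
    <⇒≱ (by-key q p (subst₂ (λ a b → f a Fin.< f b) dq dp lt))
        (subst₂ _≤_ (sym Ep) (sym Eq) (s≤s u≤w))

  stable : ∀ u w → f (lookup d′ u) ≡ f (lookup d′ w) → lookup d′ u Fin.< lookup d′ w → u Fin.< w
  stable u w eq lt with arranged u | arranged w
  ... | p , Ep , dp | q , Eq , dq = s<s⁻¹ (subst₂ _<_ Ep Eq
    (by-index p q (subst₂ (λ a b → f a ≡ f b) dp dq eq) (subst₂ Fin._<_ dp dq lt)))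

-- The program

pattern x₀ = zero
pattern x₁ = suc zero
pattern x₂ = suc (suc zero)
pattern x₃ = suc (suc (suc zero))

one : Expr 4
one = lit (pos 1)

-- The loop counter x₀ runs over the positions; body must not change it.
forUp : Prog 4 → Prog 4
forUp body = x₀ ≔ one ⨾ while var x₀ ≼ len loop (body ⨾ x₀ ≔ one ⊕ var x₀)

forDown : Prog 4 → Prog 4
forDown body = x₀ ≔ len ⨾ while one ≼ var x₀ loop (body ⨾ x₀ ≔ var x₀ ⊝ one)

clear : Prog 4
clear = forUp (E[ var x₀ ]≔ lit (pos 0))

-- Each key gets mark 1.
markImage : Prog 4
markImage = forUp (E[ D[ var x₀ ] ]≔ one ⊕ len)

-- x₀ is the next position without slot, and x₁ the next slot that a repeat may
-- get.  An entry of E is at most n if its mark is 0, and exceeds 2 n + 1 just if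
-- its mark is 2.
assignStep : Prog 4
assignStep =
  if E[ D[ var x₀ ] ] ≼ one ⊕ (len ⊕ len)
  then (E[ var x₀ ]≔ E[ var x₀ ] ⊕ D[ var x₀ ] ⨾
        E[ D[ var x₀ ] ]≔ E[ D[ var x₀ ] ] ⊕ (one ⊕ len) ⨾
        x₀ ≔ one ⊕ var x₀)
  else (if E[ var x₁ ] ≼ len
        then (E[ var x₀ ]≔ E[ var x₀ ] ⊕ var x₁ ⨾
              x₀ ≔ one ⊕ var x₀ ⨾
              x₁ ≔ one ⊕ var x₁)
        else x₁ ≔ one ⊕ var x₁)

assignTargets : Prog 4
assignTargets = x₀ ≔ one ⨾ x₁ ≔ one ⨾ while var x₀ ≼ len loop assignStep

-- All keys have been seen by now, so that each mark is 0 or 2.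
unmarkStep : Prog 4
unmarkStep =
  if E[ var x₀ ] ≼ len then skip else E[ var x₀ ]≔ E[ var x₀ ] ⊝ (lit (pos 2) ⊕ (len ⊕ len))

unmark : Prog 4
unmark = forUp unmarkStep

-- Unless the item at x₀ is at its address, it is swapped with the one at its address.
permuteStep : Prog 4
permuteStep =
  if E[ var x₀ ] ≐ var x₀
  then x₀ ≔ one ⊕ var x₀
  else (x₁ ≔ E[ var x₀ ] ⨾
        x₂ ≔D[ var x₀ ] ⨾ x₃ ≔D[ var x₁ ] ⨾
        D[ var x₀ ]≔ x₃ ⨾ D[ var x₁ ]≔ x₂ ⨾
        E[ var x₀ ]≔ E[ var x₁ ] ⨾ E[ var x₁ ]≔ var x₁)

permute : Prog 4
permute = x₀ ≔ one ⨾ while var x₀ ≼ len loop permuteStep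

countKeys : Prog 4
countKeys = forUp (E[ D[ var x₀ ] ]≔ one ⊕ E[ D[ var x₀ ] ])

-- x₁ is the sum so far.
prefixSums : Prog 4
prefixSums = x₁ ≔ lit (pos 0) ⨾ forUp (x₁ ≔ var x₁ ⊕ E[ var x₀ ] ⨾ E[ var x₀ ]≔ var x₁)

-- A position that equals its key is a leader, whose entry is the counter itself.
rankStep : Prog 4
rankStep =
  if D[ var x₀ ] ≐ var x₀
  then skip
  else (E[ var x₀ ]≔ E[ D[ var x₀ ] ] ⨾
        E[ D[ var x₀ ] ]≔ E[ D[ var x₀ ] ] ⊝ one)

assignRanks : Prog 4
assignRanks = forDown rankStep

stableSort : Prog 4
stableSort =
  clear ⨾ markImage ⨾ assignTargets ⨾ unmark ⨾ permute ⨾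
  clear ⨾ countKeys ⨾ prefixSums ⨾ assignRanks ⨾ permute

module Machine (n : ℕ) (1≤n : 1 ≤ n) (f : Fin n → Fin n) where

  -- Total correctness with time bounds

  -- Every integer that the program writes is at most 5 n.
  bound : ℕ
  bound = 5 * n

  -- P, started in s, halts within T steps in a state satisfying Q.
  record Halts (P : Prog 4) (s : State n 4) (T : ℕ) (Q : State n 4 → Set) : Set where
    constructor halts
    field
      {time}  : ℕ
      {final} : State n 4
      run     : Run f bound P s time final
      intime  : time ≤ T
      post    : Q final

  infixr 3 _⟫_ _▸_

  _⟫_ : ∀ {P Q s T U R S} → Halts P s T R → (∀ {s′} → R s′ → Halts Q s′ U S) →
    Halts (P ⨾ Q) s (T + U) S
  halts r t≤T p ⟫ next with next p
  ... | halts r′ u≤U q = halts (r ⨾ r′) (+-mono-≤ t≤T u≤U) q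

  _▸_ : ∀ {P Q s t s′ U S} → Run f bound P s t s′ → Halts Q s′ U S → Halts (P ⨾ Q) s (t + U) S
  r ▸ halts r′ u≤U q = halts (r ⨾ r′) (+-monoʳ-≤ _ u≤U) q

  atMost : ∀ {P s T U Q} → T ≤ U → Halts P s T Q → Halts P s U Q
  atMost T≤U (halts r t≤T q) = halts r (≤-trans t≤T T≤U) q

  consequence : ∀ {P s T Q R} → (∀ {s′} → Q s′ → R s′) → Halts P s T Q → Halts P s T R
  consequence Q⇒R (halts r t≤T q) = halts r t≤T (Q⇒R q)

  -- The premise of the rule for loops: each iteration preserves I within c steps,
  -- and on exit Q holds.  The index of I bounds the number of remaining iterations.
  Iteration : Cond 4 → Prog 4 → ℕ → (ℕ → State n 4 → Set) → (State n 4 → Set) → Set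
  Iteration b body c I Q = ∀ m {s} → I m s →
    (Test f s b false × Q s) ⊎
    (Test f s b true × (∃ λ m′ → m ≡ suc m′ × Halts body s c (I m′)))

  while-rule : ∀ {b body c} {I : ℕ → State n 4 → Set} {Q : State n 4 → Set} →
    Iteration b body c I Q →
    ∀ m {s} → I m s → Halts (while b loop body) s (suc m * (suc (costᶜ b) + c)) Q
  while-rule {b} {c = c} step m inv with step m inv
  ... | inj₁ (no-more , q) =
    halts (whileFalse no-more) (≤-trans (m≤m+n _ c) (m≤m+n _ (m * _))) q
  ... | inj₂ (more , m′ , refl , halts r t≤c inv′)
    with while-rule step m′ inv′
  ...   | halts r′ u≤ q =
    halts (whileTrue more r r′)
      (≤-trans (≤-reflexive (sym (+-assoc (suc (costᶜ b)) _ _)))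
               (+-mono-≤ (+-monoʳ-≤ (suc (costᶜ b)) t≤c) u≤)) q

  test-≼ : ∀ {s : State n 4} {d e y z} → Eval f s d (pos y) → Eval f s e (pos z) → y ≤ z →
    Test f s (d ≼ e) true
  test-≼ {y = y} {z} u v y≤z = subst (Test f _ _) (dec-true (pos y ℤₚ.≤? pos z) (+≤+ y≤z)) (u ≼ v)

  test-⋠ : ∀ {s : State n 4} {d e y z} → Eval f s d (pos y) → Eval f s e (pos z) → z < y →
    Test f s (d ≼ e) false
  test-⋠ {y = y} {z} u v z<y =
    subst (Test f _ _) (dec-false (pos y ℤₚ.≤? pos z) (<⇒≱ z<y ∘ ℤₚ.drop‿+≤+)) (u ≼ v)

  test-≐ : ∀ {s : State n 4} {d e y z} → Eval f s d (pos y) → Eval f s e (pos z) → y ≡ z →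
    Test f s (d ≐ e) true
  test-≐ {y = y} {z} u v y≡z = subst (Test f _ _) (dec-true (pos y ℤₚ.≟ pos z) (cong pos y≡z)) (u ≐ v)

  test-≭ : ∀ {s : State n 4} {d e y z} → Eval f s d (pos y) → Eval f s e (pos z) → y ≢ z →
    Test f s (d ≐ e) false
  test-≭ {y = y} {z} u v y≢z =
    subst (Test f _ _) (dec-false (pos y ℤₚ.≟ pos z) (y≢z ∘ ℤₚ.+-injective)) (u ≐ v)

  -- The auxiliary array is kept in the form map pos e, with natural entries e.

  readE : ∀ {d e xs x i z} → lookup e i ≡ z →
    Eval {k = 4} f (state d (map pos e) xs) x (int i) → Eval f (state d (map pos e) xs) E[ x ] (pos z)
  readE {e = e} {i = i} refl at = subst (Eval f _ _) (lookup-map i pos e) E[ at ]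

  storeE : ∀ {d e xs x y i z} →
    Eval {k = 4} f (state d (map pos e) xs) x (int i) → Eval f (state d (map pos e) xs) y (pos z) →
    z ≤ bound →
    Run f bound (E[ x ]≔ y) (state d (map pos e) xs) (suc (cost x + cost y))
      (state d (map pos (e [ i ]≔ z)) xs)
  storeE {d} {e} {xs} {i = i} at val z≤ =
    subst (λ es → Run f bound _ _ _ (state d es xs)) (sym (map-[]≔ pos e i)) (writeE at val z≤)

  small : ∀ {z} → z ≤ n → z ≤ bound
  small z≤ = ≤-trans z≤ (m≤m+n n _)

  small+ : ∀ {z} → z ≤ suc (suc (n + (n + n))) → z ≤ bound
  small+ z≤ = ≤-trans z≤
    (+-mono-≤ 1≤n (+-mono-≤ 1≤n (≤-reflexive (cong (λ m → n + (n + m)) (sym (+-identityʳ n))))))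

  1+n-fits : suc n ≤ bound
  1+n-fits = small+ (s≤s (≤-trans (m≤m+n n _) (n≤1+n _)))

  next-fits : ∀ (p : Fin n) → suc (suc (toℕ p)) ≤ bound
  next-fits p = ≤-trans (s≤s (toℕ<n p)) 1+n-fits

  -- A state with given D, x₀, x₂ and x₃ whose E and x₁ satisfy R.
  data Frame (d : Vec (Fin n) n) (c₂ c₃ c₀ : Content n) (R : Vec ℤ n → Content n → Set) :
    State n 4 → Set where
    frame : ∀ {es c₁} → R es c₁ → Frame d c₂ c₃ c₀ R (state d es (c₀ ∷ c₁ ∷ c₂ ∷ c₃ ∷ []))

  -- A bound on the cost of the body of each loop, without the loop counter.
  stepCost : ℕ
  stepCost = 60

  -- The time of a run of a loop-free program is a numeral, so that the comparison
  -- is settled by evaluation.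
  within : ∀ {P s t s′} {Q : State n 4 → Set} → Run f bound P s t s′ →
    {_ : T (t ≤ᵇ stepCost)} → Q s′ → Halts P s stepCost Q
  within r {t≤} q = halts r (≤ᵇ⇒≤ _ _ t≤) q

  -- A bound on the cost of one loop of at most 2 n iterations with its
  -- initialization: (2 n + 1) * 80 + 8 is at most 248 n, as n is positive.
  sweep : ℕ
  sweep = 300 * n

  sweep-bound : ∀ m → m ≤ n + n → 8 + suc m * 80 ≤ sweep
  sweep-bound m m≤ = begin
    8 + suc m * 80                 ≤⟨ +-mono-≤ (*-monoʳ-≤ 8 1≤n) (*-monoˡ-≤ 80 (+-mono-≤ 1≤n m≤)) ⟩
    8 * n + (n + (n + n)) * 80     ≡⟨ cong (λ m → 8 * n + m * 80) (cong (λ m → n + (n + m)) (sym (+-identityʳ n))) ⟩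
    8 * n + 3 * n * 80             ≡⟨ cong (8 * n +_) (trans (*-comm (3 * n) 80) (sym (*-assoc 80 3 n))) ⟩
    8 * n + 240 * n                ≡⟨ *-distribʳ-+ n 8 240 ⟨
    248 * n                        ≤⟨ *-monoˡ-≤ n (≤ᵇ⇒≤ 248 300 tt) ⟩
    sweep                          ∎
    where open ≤-Reasoning

  module _ {d : Vec (Fin n) n} {c₂ c₃ : Content n} {body : Prog 4}
           (I : ℕ → Vec ℤ n → Content n → Set) where

    private
      -- k iterations are done and m are left; the 1-based counter is k + 1.
      data Up : ℕ → State n 4 → Set where
        up : ∀ {k m es c₁} → k + m ≡ n → I k es c₁ →
          Up m (state d es (word (pos (suc k)) ∷ c₁ ∷ c₂ ∷ c₃ ∷ []))

      -- k iterations are left; the counter is k.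
      data Down : ℕ → State n 4 → Set where
        down : ∀ {k es c₁} → k ≤ n → I k es c₁ →
          Down k (state d es (word (pos k) ∷ c₁ ∷ c₂ ∷ c₃ ∷ []))

    forUp-rule :
      (∀ p {es c₁} → I (toℕ p) es c₁ →
        Halts body (state d es (word (int p) ∷ c₁ ∷ c₂ ∷ c₃ ∷ [])) stepCost
          (Frame d c₂ c₃ (word (int p)) (I (suc (toℕ p))))) →
      ∀ {es c₀ c₁} → I 0 es c₁ →
      Halts (forUp body) (state d es (c₀ ∷ c₁ ∷ c₂ ∷ c₃ ∷ [])) sweep
        (Frame d c₂ c₃ (word (pos (suc n))) (I n))
    forUp-rule step I₀ =
      atMost (≤-trans (+-mono-≤ (≤ᵇ⇒≤ 2 8 tt) (*-monoʳ-≤ (suc n) (≤ᵇ⇒≤ 68 80 tt)))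
               (sweep-bound n (m≤m+n n n)))
        (assign (lit _) (small 1≤n) ▸ while-rule iterate n (up refl I₀))
      where
      iterate : Iteration (var x₀ ≼ len) (body ⨾ x₀ ≔ one ⊕ var x₀) (stepCost + 4) Up
        (Frame d c₂ c₃ (word (pos (suc n))) (I n))
      iterate zero (up {k} eq i) with trans (sym (+-identityʳ k)) eq
      ... | refl = inj₁ (test-⋠ (var x₀) len ≤-refl , frame i)
      iterate (suc m) (up eq i) with below eq
      ... | p , refl = inj₂ (test-≼ (var x₀) len (toℕ<n p) , m , refl ,
        (step p i ⟫ λ { (frame i′) →
          halts (assign (lit _ ⊕ var x₀) (next-fits p))
            ≤-refl (up (trans (sym (+-suc _ m)) eq) i′) }))

    forDown-rule :
      (∀ p {es c₁} → I (suc (toℕ p)) es c₁ →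
        Halts body (state d es (word (int p) ∷ c₁ ∷ c₂ ∷ c₃ ∷ [])) stepCost
          (Frame d c₂ c₃ (word (int p)) (I (toℕ p)))) →
      ∀ {es c₀ c₁} → I n es c₁ →
      Halts (forDown body) (state d es (c₀ ∷ c₁ ∷ c₂ ∷ c₃ ∷ [])) sweep
        (Frame d c₂ c₃ (word (pos 0)) (I 0))
    forDown-rule step I₀ =
      atMost (≤-trans (+-mono-≤ (≤ᵇ⇒≤ 2 8 tt) (*-monoʳ-≤ (suc n) (≤ᵇ⇒≤ 68 80 tt)))
               (sweep-bound n (m≤m+n n n)))
        (assign len (small ≤-refl) ▸ while-rule iterate n (down ≤-refl I₀))
      where
      iterate : Iteration (one ≼ var x₀) (body ⨾ x₀ ≔ var x₀ ⊝ one) (stepCost + 4) Down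
        (Frame d c₂ c₃ (word (pos 0)) (I 0))
      iterate zero (down _ i) = inj₁ (test-⋠ (lit _) (var x₀) ≤-refl , frame i)
      iterate (suc m) (down m<n i) with fromℕ< m<n | toℕ-fromℕ< m<n
      ... | p | refl = inj₂ (test-≼ (lit _) (var x₀) (s≤s z≤n) , m , refl ,
        (step p i ⟫ λ { (frame i′) →
          halts (assign (var x₀ ⊝ lit _) (small (<⇒≤ m<n))) ≤-refl (down (<⇒≤ m<n) i′) }))

  -- The auxiliary array has natural entries, and they satisfy R.
  data Holds (R : Vec ℕ n → Set) : Vec ℤ n → Set where
    holds : ∀ {e} → R e → Holds R (map pos e)

  -- The arrays satisfy Q; the variables are arbitrary.
  data Meets (Q : Vec (Fin n) n → Vec ℕ n → Set) : State n 4 → Set where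
    meets : ∀ {d e xs} → Q d e → Meets Q (state d (map pos e) xs)

  -- The rule for ascending loops that change no array but E, where only E matters.
  sweepE : ∀ {body d} (R : ℕ → Vec ℕ n → Set) →
    (∀ p {e c₁ c₂ c₃} → R (toℕ p) e →
      Halts body (state d (map pos e) (word (int p) ∷ c₁ ∷ c₂ ∷ c₃ ∷ [])) stepCost
        (Frame d c₂ c₃ (word (int p)) (λ es _ → Holds (R (suc (toℕ p))) es))) →
    ∀ {e xs} → R 0 e →
    Halts (forUp body) (state d (map pos e) xs) sweep (Meets λ d′ e′ → d′ ≡ d × R n e′)
  sweepE R step {xs = _ ∷ _ ∷ _ ∷ _ ∷ []} R₀ =
    consequence (λ { (frame (holds r)) → meets (refl , r) })
      (forUp-rule (λ k es _ → Holds (R k) es) (λ { p (holds r) → step p r }) (holds R₀))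

  Zero : Vec ℕ n → Set
  Zero e = ∀ u → lookup e u ≡ 0

  clear-correct : ∀ {d es xs} →
    Halts clear (state d es xs) sweep (Meets λ d′ e → d′ ≡ d × Zero e)
  clear-correct {d} {xs = _ ∷ _ ∷ _ ∷ _ ∷ []} =
    consequence done (forUp-rule Cleared
      (λ p {es} zeros → within (writeE {i = p} (var x₀) (lit (pos 0)) z≤n)
        (frame λ u u≤p → case <suc-split u≤p of λ
          { (inj₂ refl) → lookup∘update u es _
          ; (inj₁ u<p) → trans (lookup∘update′ (λ u≡p → <⇒≢ u<p (cong toℕ u≡p)) es _) (zeros u u<p) }))
      λ _ ())
    where
    Cleared : ℕ → Vec ℤ n → Content n → Set
    Cleared k es _ = ∀ u → toℕ u < k → lookup es u ≡ pos 0

    done : ∀ {s c₀ c₂ c₃} → Frame d c₂ c₃ c₀ (Cleared n) s → Meets (λ d′ e → d′ ≡ d × Zero e) s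
    done (frame {es} zeros) with vec-ext {xs = es} {map pos (replicate n 0)} (λ u → trans (zeros u (toℕ<n u))
      (sym (trans (lookup-map u pos (replicate n 0)) (cong pos (lookup-replicate u 0)))))
    ... | refl = meets (refl , λ u → lookup-replicate u 0)

  -- Correctness of the loops that do not move items

  module _ (d : Vec (Fin n) n) where
    private
      key : Fin n → Fin n
      key p = f (lookup d p)
    open Slots key
    open Ranks key

    ImageMarked : ℕ → Vec ℕ n → Set
    ImageMarked k e = ∀ u →
      (lookup e u ≡ suc n × Image u) ⊎
      (lookup e u ≡ 0 × (∀ p → toℕ p < k → key p ≢ u))

    markImage-correct : ∀ {e xs} → Zero e →
      Halts markImage (state d (map pos e) xs) sweep (Meets λ d′ e′ → d′ ≡ d × ImageMarked n e′)
    markImage-correct e≡0 = sweepE ImageMarked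
      (λ p {e} marked → within
        (storeE {e = e} D[ var x₀ ] (lit _ ⊕ len) 1+n-fits)
        (frame (holds λ u → case updated e (key p) (suc n) u of λ
          { (inj₁ (refl , eq)) → inj₁ (eq , p , refl)
          ; (inj₂ (u≢v , eq)) → case marked u of λ
            { (inj₁ (eq′ , im)) → inj₁ (trans eq eq′ , im)
            ; (inj₂ (eq′ , none)) → inj₂ (trans eq eq′ , λ q q≤p → case <suc-split q≤p of λ
              { (inj₁ q<p) → none q q<p ; (inj₂ refl) → u≢v ∘ sym }) } })))
      (λ u → inj₂ (e≡0 u , λ _ ()))

    start-coded : ∀ {e} → ImageMarked n e → Coded 0 0 e
    start-coded marked = record
      { assigned = none-assigned {T = replicate n 0} (λ p → lookup-replicate p 0)
      ; code = λ u → case marked u of λ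
          { (inj₁ (eq , im)) → 1 , fresh im (λ _ ()) ,
              trans eq (sym (cong₂ _+_ (lookup-replicate u 0) (+-identityʳ (suc n))))
          ; (inj₂ (eq , none)) → 0 , blank (λ { (p , eq′) → none p (toℕ<n p) eq′ }) ,
              trans eq (sym (cong (_+ 0) (lookup-replicate u 0))) } }

    private
      -- i positions are without slot, and j slots have not been considered; each
      -- iteration decreases i + j.
      data Assigning : ℕ → State n 4 → Set where
        assigning : ∀ {i j k l m e c₂ c₃} → k + i ≡ n → l + j ≡ n → i + j ≤ m → Coded k l e →
          Assigning m (state d (map pos e) (word (pos (suc k)) ∷ word (pos (suc l)) ∷ c₂ ∷ c₃ ∷ []))

      succ : ∀ {k i} → k + suc i ≡ n → suc k + i ≡ n
      succ {k} {i} eq = trans (sym (+-suc k i)) eq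

      marked-big : ∀ {x} t m → x ≡ t + suc m * suc n → n < x
      marked-big t m refl = ≤-trans (m≤m+n (suc n) (m * suc n)) (m≤n+m _ t)

      repeat-step : ∀ {i j l m e c₂ c₃} (p : Fin n) → toℕ p + suc i ≡ n → l + j ≡ n → i + j ≤ m →
        Coded (toℕ p) l e → Repeat p → ∀ t → lookup e (key p) ≡ t + 2 * suc n →
        Halts assignStep (state d (map pos e) (word (int p) ∷ word (pos (suc l)) ∷ c₂ ∷ c₃ ∷ []))
          stepCost (Assigning m)
      repeat-step {j = zero} {l} p _ eqₗ _ C rep _ _ =
        contradiction (trans (sym (+-identityʳ l)) eqₗ) (slot-left p (Coded.assigned C) rep)
      repeat-step {i} {suc j} {l} {m} {e} p eqₖ eqₗ i+j≤m C rep t eq = next-slot (below eqₗ)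
        where
        occupied : ∀ {c₁ c₂ c₃} → Test f (state d (map pos e) (word (int p) ∷ c₁ ∷ c₂ ∷ c₃ ∷ []))
          (E[ D[ var x₀ ] ] ≼ one ⊕ (len ⊕ len)) false
        occupied = test-⋠ (readE {e = e} eq D[ var x₀ ]) (lit _ ⊕ (len ⊕ len))
          (≤-trans (≤-reflexive (sym two-marks)) (m≤n+m _ t))

        -- A slot in the image is skipped.
        in-image : ∀ {c₂ c₃} u {x} → toℕ u ≡ l → Image u → lookup e u ≡ x → n < x →
          Halts assignStep (state d (map pos e) (word (int p) ∷ word (pos (suc l)) ∷ c₂ ∷ c₃ ∷ []))
            stepCost (Assigning m)
        in-image u refl im eq′ n<x = within
          (ifFalse occupied (ifFalse (test-⋠ (readE {e = e} eq′ (var x₁)) len n<x)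
            (assign (lit _ ⊕ var x₁) (next-fits u))))
          (assigning {i = suc i} {j} {e = e} eqₖ (succ eqₗ) (≤-trans (≤-reflexive (sym (+-suc i j))) i+j≤m)
            (code-skip u im C))

        next-slot : (∃ λ u → toℕ u ≡ l) → Halts _ _ _ _
        next-slot (u , refl) with Coded.code C u
        ... | _ , fresh im _ , eq′ = in-image u refl im eq′ (marked-big _ 0 refl)
        ... | _ , seen q _ key≡ , eq′ = in-image u refl (q , key≡) eq′ (marked-big _ 1 refl)
        ... | _ , blank ¬im , eq′ = within
          (ifFalse occupied (ifTrue
            (test-≼ (readE {e = e} (trans eq′ (+-identityʳ _)) (var x₁)) len (Assigned.slot≤n (Coded.assigned C) u))
            (storeE (var x₀) (readE {e = e} refl (var x₀) ⊕ var x₁) (small+ (claim-bound p C _ (toℕ<n u))) ⨾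
             assign (lit _ ⊕ var x₀) (next-fits p) ⨾
             assign (lit _ ⊕ var x₁) (next-fits u))))
          (assigning {i = i} {j} (succ eqₖ) (succ eqₗ) (≤-trans (+-monoʳ-≤ i (n≤1+n j)) i+j≤m)
            (code-repeat p C u refl ¬im rep))

      leader-step : ∀ {i j l m e c₂ c₃} (p : Fin n) → toℕ p + suc i ≡ n → l + j ≡ n → i + j ≤ m →
        Coded (toℕ p) l e → (∀ q → toℕ q < toℕ p → key q ≢ key p) →
        ∀ t → t ≤ n → lookup e (key p) ≡ t + 1 * suc n →
        Halts assignStep (state d (map pos e) (word (int p) ∷ word (pos (suc l)) ∷ c₂ ∷ c₃ ∷ []))
          stepCost (Assigning m)
      leader-step {e = e} p eqₖ eqₗ i+j≤m C unseen t t≤n eq = within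
        (ifTrue
          (test-≼ (readE {e = e} eq D[ var x₀ ]) (lit _ ⊕ (len ⊕ len))
            (≤-trans (+-mono-≤ t≤n (≤-reflexive (+-identityʳ (suc n)))) (≤-reflexive (+-suc n n))))
          (storeE (var x₀) (readE {e = e} refl (var x₀) ⊕ D[ var x₀ ])
             (small+ (claim-bound p C _ (toℕ<n (key p)))) ⨾
           storeE D[ var x₀ ] (readE {e = e₁} refl D[ var x₀ ] ⊕ (lit _ ⊕ len))
             (small+ (subst (_≤ _) (lookup∘update (key p) e₁ _) (coded-bound C′ (key p)))) ⨾
           assign (lit _ ⊕ var x₀) (next-fits p)))
        (assigning (succ eqₖ) eqₗ i+j≤m C′)
        where
        e₁ = e [ p ]≔ (lookup e p + suc (toℕ (key p)))
        C′ = code-leader p C unseen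

    assignTargets-correct : ∀ {e xs} → ImageMarked n e →
      Halts assignTargets (state d (map pos e) xs) sweep
        (Meets λ d′ e′ → d′ ≡ d × ∃ λ l → Coded n l e′)
    assignTargets-correct {xs = _ ∷ _ ∷ _ ∷ _ ∷ []} marked =
      atMost (≤-trans (+-mono-≤ (≤ᵇ⇒≤ 4 8 tt) (*-monoʳ-≤ (suc (n + n)) (≤ᵇ⇒≤ 64 80 tt)))
               (sweep-bound (n + n) ≤-refl))
        (assign (lit _) (small 1≤n) ▸ assign (lit _) (small 1≤n) ▸
         while-rule iterate (n + n) (assigning refl refl ≤-refl (start-coded marked)))
      where
      iterate : Iteration (var x₀ ≼ len) assignStep stepCost Assigning
        (Meets λ d′ e′ → d′ ≡ d × ∃ λ l → Coded n l e′)
      iterate _ (assigning {zero} {k = k} eq _ _ C) with trans (sym (+-identityʳ k)) eq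
      ... | refl = inj₁ (test-⋠ (var x₀) len ≤-refl , meets (refl , _ , C))
      iterate (suc m) (assigning {suc i} eqₖ eqₗ (s≤s i+j≤m) C) with below eqₖ
      ... | p , refl with Coded.code C (key p)
      ...   | _ , blank ¬im , _ = contradiction (p , refl) ¬im
      ...   | _ , fresh _ unseen , eq = inj₂ (test-≼ (var x₀) len (toℕ<n p) , m , refl ,
                leader-step p eqₖ eqₗ i+j≤m C unseen _ (Assigned.slot≤n (Coded.assigned C) (key p)) eq)
      ...   | _ , seen q q<p same , eq = inj₂ (test-≼ (var x₀) len (toℕ<n p) , m , refl ,
                repeat-step p eqₖ eqₗ i+j≤m C (q , q<p , same) _ eq)

    -- At the end every position of the image is marked twice.
    unmark-correct : ∀ {e xs l} → Coded n l e →
      Halts unmark (state d (map pos e) xs) sweep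
        (Meets λ d′ e′ → d′ ≡ d × Assigned n l e′)
    unmark-correct {e₀} {l = l} C =
      consequence (λ { (meets (eq , dec)) → meets (eq , assigned-cong (λ u → sym (proj₁ (dec u) (toℕ<n u))) assigned) })
        (sweepE Unmarked
          (λ p {e} U → unmark-step p e U (code p))
          (λ u → (λ ()) , λ _ → refl))
      where
      open Coded C

      Unmarked : ℕ → Vec ℕ n → Set
      Unmarked k e = ∀ u → (toℕ u < k → lookup e u ≡ lookup slots u) ×
                           (k ≤ toℕ u → lookup e u ≡ lookup e₀ u)

      unmark-step : ∀ p e {c₁ c₂ c₃} → Unmarked (toℕ p) e →
        (∃ λ m → Mark n p m × lookup e₀ p ≡ lookup slots p + m * suc n) →
        Halts unmarkStep (state d (map pos e) (word (int p) ∷ c₁ ∷ c₂ ∷ c₃ ∷ [])) stepCost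
          (Frame d c₂ c₃ (word (int p)) (λ es _ → Holds (Unmarked (suc (toℕ p))) es))
      unmark-step p e U (_ , fresh (q , eq) unseen , _) = contradiction eq (unseen q (toℕ<n q))
      unmark-step p e U (_ , blank _ , eq) = within
        (ifTrue (test-≼ (readE {e = e} slot (var x₀)) len (Assigned.slot≤n assigned p)) skip)
        (frame (holds λ u → (λ u≤p → case <suc-split u≤p of λ
            { (inj₁ u<p) → proj₁ (U u) u<p ; (inj₂ refl) → slot })
          , λ p<u → proj₂ (U u) (<⇒≤ p<u)))
        where slot = trans (proj₂ (U p) ≤-refl) (trans eq (+-identityʳ _))
      unmark-step p e U (_ , seen _ _ _ , eq) = within
        (ifFalse (test-⋠ (readE {e = e} ep (var x₀)) len (marked-big _ 1 refl))
          (storeE (var x₀) (subst (Eval f _ _) subtract (readE {e = e} ep (var x₀) ⊝ (lit _ ⊕ (len ⊕ len))))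
            (small (Assigned.slot≤n assigned p))))
        (frame (holds λ u → case updated e p (lookup slots p) u of λ
          { (inj₁ (refl , eq′)) → (λ _ → eq′) , λ p<p → contradiction p<p 1+n≰n
          ; (inj₂ (u≢p , eq′)) → (λ u≤p → case <suc-split u≤p of λ
                { (inj₁ u<p) → trans eq′ (proj₁ (U u) u<p) ; (inj₂ refl) → contradiction refl u≢p })
              , λ p<u → trans eq′ (proj₂ (U u) (<⇒≤ p<u)) }))
        where
        ep = trans (proj₂ (U p) ≤-refl) eq
        subtract : pos (lookup slots p + 2 * suc n) ℤ.- pos (2 + (n + n)) ≡ pos (lookup slots p)
        subtract = trans (cong (λ x → pos (lookup slots p + x) ℤ.- pos (2 + (n + n))) two-marks)
          (trans (ℤₚ.⊖-≥ (m≤n+m (2 + (n + n)) (lookup slots p))) (cong pos (m+n∸n≡m (lookup slots p) (2 + (n + n)))))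

    countKeys-correct : ∀ {e xs} → Zero e →
      Halts countKeys (state d (map pos e) xs) sweep
        (Meets λ d′ e′ → d′ ≡ d × (∀ u → lookup e′ u ≡ occ n u))
    countKeys-correct e≡0 = sweepE (λ k e → ∀ u → lookup e u ≡ occ k u)
      (λ p {e} counts →
        let hit = trans (cong suc (counts (key p))) (sym (occ-hit p)) in
        within
          (storeE {e = e} D[ var x₀ ] (lit _ ⊕ readE {e = e} refl D[ var x₀ ])
            (small (≤-trans (≤-reflexive hit) (occ≤n p (key p)))))
          (frame (holds λ u → case updated e (key p) (suc (lookup e (key p))) u of λ
            { (inj₁ (refl , eq)) → trans eq hit
            ; (inj₂ (u≢v , eq)) → trans eq (trans (counts u) (sym (occ-miss p u (u≢v ∘ sym)))) })))
      e≡0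

    private
      data Summed (k : ℕ) : Vec ℤ n → Content n → Set where
        summed : ∀ {e} →
          (∀ u → (toℕ u < k → lookup e u ≡ start (suc (toℕ u))) × (k ≤ toℕ u → lookup e u ≡ occ n u)) →
          Summed k (map pos e) (word (pos (start k)))

    prefixSums-correct : ∀ {e xs} → (∀ u → lookup e u ≡ occ n u) →
      Halts prefixSums (state d (map pos e) xs) (sweep + sweep)
        (Meets λ d′ e′ → d′ ≡ d × (∀ u → lookup e′ u ≡ start (suc (toℕ u))))
    prefixSums-correct {xs = _ ∷ _ ∷ _ ∷ _ ∷ []} counts =
      atMost (+-monoˡ-≤ sweep (≤-trans (≤ᵇ⇒≤ 2 300 tt) (*-monoʳ-≤ 300 1≤n)))
        (assign (lit _) z≤n ▸
         consequence (λ { (frame (summed sums)) → meets (refl , λ u → proj₁ (sums u) (toℕ<n u)) })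
           (forUp-rule Summed (λ p → step p) (summed λ u → (λ ()) , λ _ → counts u)))
      where
      step : ∀ p {es c₁ c₂ c₃} → Summed (toℕ p) es c₁ →
        Halts (x₁ ≔ var x₁ ⊕ E[ var x₀ ] ⨾ E[ var x₀ ]≔ var x₁)
          (state d es (word (int p) ∷ c₁ ∷ c₂ ∷ c₃ ∷ [])) stepCost
          (Frame d c₂ c₃ (word (int p)) (Summed (suc (toℕ p))))
      step p (summed {e} sums) = within
        (assign (subst (Eval f _ _) (cong pos (sym (∑-suc (occ n) p)))
                  (var x₁ ⊕ readE {e = e} (proj₂ (sums p) ≤-refl) (var x₀))) (small (start≤n p)) ⨾
         storeE {e = e} (var x₀) (var x₁) (small (start≤n p)))
        (frame (summed λ u → case updated e p (start (suc (toℕ p))) u of λ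
          { (inj₁ (refl , eq)) → (λ _ → eq) , λ p<p → contradiction p<p 1+n≰n
          ; (inj₂ (u≢p , eq)) → (λ u≤p → case <suc-split u≤p of λ
                { (inj₁ u<p) → trans eq (proj₁ (sums u) u<p) ; (inj₂ refl) → contradiction refl u≢p })
              , λ p<u → trans eq (proj₂ (sums u) (<⇒≤ p<u)) }))

    assignRanks-correct : ∀ {e xs} → (∀ u → key (key u) ≡ key u) →
      (∀ u → lookup e u ≡ start (suc (toℕ u))) →
      Halts assignRanks (state d (map pos e) xs) sweep (Meets λ d′ e′ → d′ ≡ d × Ranked 0 e′)
    assignRanks-correct {xs = _ ∷ _ ∷ _ ∷ _ ∷ []} idempotent starts =
      consequence (λ { (frame (holds R)) → meets (refl , R) })
        (forDown-rule (λ k es _ → Holds (Ranked k) es) (λ { p (holds R) → step p R })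
          (holds (unranked starts)))
      where
      step : ∀ p {e c₁ c₂ c₃} → Ranked (suc (toℕ p)) e →
        Halts rankStep (state d (map pos e) (word (int p) ∷ c₁ ∷ c₂ ∷ c₃ ∷ [])) stepCost
          (Frame d c₂ c₃ (word (int p)) (λ es _ → Holds (Ranked (toℕ p)) es))
      step p {e} R with key p Finₚ.≟ p
      ... | yes fix = within
        (ifTrue (test-≐ D[ var x₀ ] (var x₀) (cong (suc ∘ toℕ) fix)) skip)
        (frame (holds (rank-fixed p fix R)))
      ... | no moved with counter idempotent p R
      ...   | x , eq = within
        (ifFalse (test-≭ D[ var x₀ ] (var x₀) (moved ∘ toℕ-injective ∘ suc-injective))
          (storeE {e = e} (var x₀) (readE {e = e} refl D[ var x₀ ]) (small ev≤n) ⨾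
           storeE {e = e₁} D[ var x₀ ] (readE {e = e₁} (trans (lookup∘update′ moved e _) eq) D[ var x₀ ] ⊝ lit _)
             (small (≤-trans (n≤1+n x) (≤-trans (≤-reflexive (sym eq)) ev≤n)))))
        (frame (holds (rank-moved idempotent p moved R eq)))
        where
        e₁ = e [ p ]≔ lookup e (key p)
        ev≤n = ≤-trans (Ranked.capped R (key p) (idempotent p)) (start≤n (key p))

  -- Moving the items to their addresses

  misplaced? : ∀ (e : Vec ℕ n) p → Dec (lookup e p ≢ suc (toℕ p))
  misplaced? e p = ¬? (lookup e p ≟ⁿ suc (toℕ p))

  -- The number of positions p whose item is not addressed to p.  It decreases with
  -- each swap.
  misplaced : Vec ℕ n → ℕ
  misplaced e = ∑ (λ p → indicator (misplaced? e p)) n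

  module _ (d₀ : Vec (Fin n) n) (e₀ : Vec ℕ n) where

    -- Each item still has the address that it had in the arrays d₀ and e₀.
    Carried : Vec (Fin n) n → Vec ℕ n → Set
    Carried d e = ∀ p → ∃ λ q → lookup e p ≡ lookup e₀ q × lookup d p ≡ lookup d₀ q

    private
      data Permuting : ℕ → State n 4 → Set where
        permuting : ∀ {i k m d e c₁ c₂ c₃} → k + i ≡ n → (∀ p → toℕ p < k → lookup e p ≡ suc (toℕ p)) →
          Addressing e → Carried d e → i + misplaced e ≤ m →
          Permuting m (state d (map pos e) (word (pos (suc k)) ∷ c₁ ∷ c₂ ∷ c₃ ∷ []))

    permute-correct : ∀ {xs} → Addressing e₀ →
      Halts permute (state d₀ (map pos e₀) xs) sweep (Meets λ d _ → Arranged d₀ e₀ d)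
    permute-correct {xs = _ ∷ _ ∷ _ ∷ _ ∷ []} addr =
      atMost (≤-trans (+-mono-≤ (≤ᵇ⇒≤ 2 8 tt) (*-monoʳ-≤ (suc (n + n)) (≤ᵇ⇒≤ 64 80 tt)))
               (sweep-bound (n + n) ≤-refl))
        (assign (lit _) (small 1≤n) ▸
         while-rule iterate (n + n) (permuting refl (λ _ ()) addr (λ p → p , refl , refl)
           (+-monoʳ-≤ n (≤-trans (∑-bound (λ p → indicator≤1 (misplaced? e₀ p)) n) (≤-reflexive (*-identityʳ n))))))
      where
      move : ∀ {i m d e c₁ c₂ c₃} (p : Fin n) → toℕ p + suc i ≡ n →
        (∀ q → toℕ q < toℕ p → lookup e q ≡ suc (toℕ q)) → Addressing e → Carried d e →
        suc i + misplaced e ≤ suc m → lookup e p ≢ suc (toℕ p) →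
        Halts permuteStep (state d (map pos e) (word (int p) ∷ c₁ ∷ c₂ ∷ c₃ ∷ [])) stepCost (Permuting m)
      move {i} {m} {d} {e} p eq done A carried le wrong with Addressing.target A p
      ... | u , here = within
        (ifFalse (test-≭ (readE {e = e} refl (var x₀)) (var x₀) wrong)
          (assign (readE {e = e} refl (var x₀)) (small ep≤n) ⨾
           pickUp {i = p} (var x₀) ⨾ pickUp {i = u} at-u ⨾
           putDown {i = p} (var x₀) refl ⨾ putDown {i = u} at-u refl ⨾
           storeE {e = e} (var x₀) (readE {e = e} refl at-u) (small eu≤n) ⨾
           storeE {e = e [ p ]≔ lookup e u} at-u (var x₁) (small ep≤n)))
        (permuting {i = suc i} {e = e′} eq done′ A′ carried′ le′)
        where
        open Addressing A
        e′ = e [ p ]≔ lookup e u [ u ]≔ lookup e p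
        τ  = transpose p u

        at-u : ∀ {d es c₀ c₂ c₃} →
          Eval f (state d es (c₀ ∷ word (pos (lookup e p)) ∷ c₂ ∷ c₃ ∷ [])) (var x₁) (int u)
        at-u = subst (Eval f _ _) (cong pos here) (var x₁)

        fits : ∀ q → lookup e q ≤ n
        fits q = subst (_≤ n) (sym (proj₂ (target q))) (toℕ<n (proj₁ (target q)))
        ep≤n = fits p
        eu≤n = fits u

        u-wrong : lookup e u ≢ suc (toℕ u)
        u-wrong eq′ = wrong (subst (λ q → lookup e q ≡ suc (toℕ q)) (distinct u p (trans eq′ (sym here))) eq′)

        e′-u : lookup e′ u ≡ suc (toℕ u)
        e′-u = trans (lookup∘update u (e [ p ]≔ lookup e u) (lookup e p)) here

        e′-other : ∀ q → q ≢ p → q ≢ u → lookup e′ q ≡ lookup e q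
        e′-other q q≢p q≢u = trans (lookup∘update′ q≢u (e [ p ]≔ lookup e u) (lookup e p)) (lookup∘update′ q≢p e (lookup e u))

        done′ : ∀ q → toℕ q < toℕ p → lookup e′ q ≡ suc (toℕ q)
        done′ q q<p with q Finₚ.≟ u
        ... | yes refl = e′-u
        ... | no  q≢u  = trans (e′-other q (λ q≡p → <⇒≢ q<p (cong toℕ q≡p)) q≢u) (done q q<p)

        A′ : Addressing e′
        A′ = record
          { target = λ q → proj₁ (target (τ q)) , trans (lookup-exchange e p u q) (proj₂ (target (τ q)))
          ; distinct = λ q r eq′ → transpose-injective p u
              (distinct (τ q) (τ r) (trans (sym (lookup-exchange e p u q)) (trans eq′ (lookup-exchange e p u r)))) }

        carried′ : Carried (d [ p ]≔ lookup d u [ u ]≔ lookup d p) e′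
        carried′ q with carried (τ q)
        ... | r , eqₑ , eq_d = r , trans (lookup-exchange e p u q) eqₑ , trans (lookup-exchange d p u q) eq_d

        -- The swap corrects entry u, which was wrong, and entry p was wrong before.
        fewer : misplaced e′ + 1 ≤ misplaced e + 0
        fewer = ∑-change 1 0 u
          (≤-reflexive (trans (cong (_+ 1) (indicator-false (misplaced? e′ u) (λ ≢u → ≢u e′-u)))
            (sym (trans (+-identityʳ _) (indicator-true (misplaced? e u) u-wrong)))))
          (λ q q≢u → case q Finₚ.≟ p of λ
            { (yes refl) → ≤-trans (indicator≤1 (misplaced? e′ q)) (≤-reflexive (sym (indicator-true (misplaced? e q) wrong)))
            ; (no q≢p) → ≤-reflexive (cong (λ x → indicator (¬? (x ≟ⁿ suc (toℕ q)))) (e′-other q q≢p q≢u)) })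

        le′ : suc i + misplaced e′ ≤ m
        le′ = ≤-trans (≤-reflexive (sym (+-suc i _)))
          (≤-trans (+-monoʳ-≤ i (subst₂ _≤_ (+-comm _ 1) (+-identityʳ _) fewer)) (s≤s⁻¹ le))

      iterate : Iteration (var x₀ ≼ len) permuteStep stepCost Permuting (Meets λ d _ → Arranged d₀ e₀ d)
      iterate _ (permuting {zero} {k} eq done _ carried _) with trans (sym (+-identityʳ k)) eq
      ... | refl = inj₁ (test-⋠ (var x₀) len ≤-refl , meets λ u → case carried u of λ
              { (q , eqₑ , eq_d) → q , trans (sym eqₑ) (done u (toℕ<n u)) , eq_d })
      iterate (suc m) (permuting {suc i} {e = e} eq done A carried le) with below eq
      ... | p , refl with lookup e p ≟ⁿ suc (toℕ p)
      ...   | no wrong = inj₂ (test-≼ (var x₀) len (toℕ<n p) , m , refl , move p eq done A carried le wrong)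
      ...   | yes right = inj₂ (test-≼ (var x₀) len (toℕ<n p) , m , refl , within
        (ifTrue (test-≐ (readE {e = e} refl (var x₀)) (var x₀) right)
          (assign (lit _ ⊕ var x₀) (next-fits p)))
        (permuting {i = i} (trans (sym (+-suc _ i)) eq)
          (λ q q≤p → case <suc-split q≤p of λ { (inj₁ q<p) → done q q<p ; (inj₂ refl) → right })
          A carried (s≤s⁻¹ le)))

  -- The whole program

  stableSort-correct : ∀ {es xs} →
    Halts stableSort (initial es xs) (3300 * n) (StablySorted f ∘ arrD)
  stableSort-correct {es} {xs} = atMost total
    (clear-correct                             ⟫ λ { (meets (refl , e≡0)) →
     markImage-correct _ e≡0                   ⟫ λ { (meets (refl , marked)) →
     assignTargets-correct _ marked            ⟫ λ { (meets (refl , _ , C)) →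
     unmark-correct _ C                        ⟫ λ { (meets {e = T} (refl , A)) →
     permute-correct _ T (Slots.addressing _ A) ⟫ λ { (meets {d} arr) →
     let G = grouped {d = d} (λ p → cong f (lookup-allFin p)) A (at-slot T d arr) in
     clear-correct                             ⟫ λ { (meets (refl , e≡0)) →
     countKeys-correct _ e≡0                   ⟫ λ { (meets (refl , counts)) →
     prefixSums-correct _ counts               ⟫ λ { (meets (refl , starts)) →
     assignRanks-correct _ (Grouped.idempotent G) starts ⟫ λ { (meets (refl , R)) →
     let S = stable-ranks G R in
     atMost (≤-reflexive (sym (+-identityʳ sweep)))
       (consequence (λ { (meets arr′) → stably-sorted (Grouped.injective G) S arr′ })
         (permute-correct _ _ (StableRanks.addresses S))) } } } } } } } } })
    where
    at-slot : ∀ T d → Arranged (allFin n) T d → ∀ u → lookup T (lookup d u) ≡ suc (toℕ u)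
    at-slot T _ arr u with arr u
    ... | p , eq , here = trans (cong (lookup T) (trans here (lookup-allFin p))) eq

    -- Ten loops, and the initialization of the running sum within another sweep.
    total : sweep + (sweep + (sweep + (sweep + (sweep + (sweep + (sweep +
              ((sweep + sweep) + (sweep + (sweep + 0))))))))) ≤ 3300 * n
    total = ≤-reflexive (trans
      (cong (λ t → sweep + (sweep + (sweep + (sweep + (sweep + (sweep + (sweep + t)))))))
            (+-assoc sweep sweep _))
      (sym (*-assoc 11 300 n)))

theorem4p3 : Σ[ P ∈ Prog 4 ] Σ[ b ∈ ℕ ] Σ[ c ∈ ℕ ]
    ((n : ℕ) → 1 ≤ n → (f : Fin n → Fin n) →
    (es : Vec ℤ n) (xs : Vec (Content n) 4) →
    Σ[ t ∈ ℕ ] Σ[ s ∈ State n 4 ]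
    (Run f (b * n) P (initial es xs) t s × t ≤ c * n × StablySorted f (arrD s)))
theorem4p3 = stableSort , 5 , 3300 , λ n 1≤n f es xs →
  let open Machine n 1≤n f
      open Halts (stableSort-correct {es} {xs})
  in _ , _ , run , intime , post
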